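{- For every ITL formula $A$ and every state formula $w$ there exists a $\Pi^{ -1}$-free ITL formula $A'$ that is equivalent to $w\,\Pi^{ -1}A$, i.e. such that for every interval $\sigma$: $\sigma\models A'$ iff $\sigma\models w\,\Pi^{ -1}A$.
   Context: ITL formulas over a finite vocabulary $V$ of propositional variables: $A::=\bot\mid p\mid A\supset A\mid\bigcirc A\mid A;A\mid A^*$. A state formula is built from $\bot$, variables and $\supset$ only. With $\Sigma=\mathcal P(V)$, an interval is a non-empty finite or a right-infinite sequence $\sigma=\sigma^0\sigma^1\ldots$ of states from $\Sigma$. Satisfaction: $\sigma\not\models\bot$; $\sigma\models p$ iff $p\in\sigma^0$; $\supset$ is classical; $\sigma\models\bigcirc A$ iff $\sigma$ has at least two states and $\sigma^1\sigma^2\ldots\models A$; $\sigma\models A;B$ iff for some position $k$ of $\sigma$, $\sigma^0\ldots\sigma^k\models A$ and $\sigma^k\sigma^{k+1}\ldots\models B$ (strong chop); $\sigma\models A^*$ iff $\sigma$ has a single state, or $\sigma$ can be divided at an increasing finite sequence of positions $0=k_0<k_1<\cdots$ into finitely many consecutive subintervals (adjacent ones sharing their common end state, each with at least two states, the last one being infinite if $\sigma$ is infinite), each satisfying $A$, or $\sigma$ is infinite and can be divided in this way into infinitely many finite subintervals, each satisfying $A$. Given an interval $\sigma'$ and a state formula $w$, $\sigma'|_w$ denotes the (possibly empty) sequence obtained by deleting from $\sigma'$ all the states $x$ with $x\not\models w$. The connective $\Pi^{ -1}$ (inverse of the projection operator with respect to its second operand) is defined by: $\sigma\models w\,\Pi^{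 -1}A$ iff there exists an interval $\sigma'$ such that $\sigma'|_w=\sigma$ and $\sigma'\models A$. -}

module Defs where

open import Data.Empty using (⊥)
open import Data.Fin.Base using (Fin)
open import Data.Fin.Subset using (Subset; _∈_)
open import Data.Nat.Base using (ℕ; suc; _+_; _∸_; _≤_; _<_)
open import Data.Product.Base using (_×_; ∃-syntax)
open import Data.Sum.Base using (_⊎_)
open import Data.Unit.Base using (⊤)
open import Function.Base using (_∘_)
open import Relation.Nullary.Negation.Core using (¬_)
open import Relation.Binary.PropositionalEquality.Core using (_≡_)

infixr 5 _⊃_
infixr 6 _⨾_
infix  7 ○_
infix  8 _✶

-- The vocabulary is V = Fin n.
data ITL (n : ℕ) : Set where
  ⊥′  : ITL n
  var : Fin n → ITL n
  _⊃_ : ITL n → ITL n → ITL n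
  ○_  : ITL n → ITL n
  _⨾_ : ITL n → ITL n → ITL n
  _✶  : ITL n → ITL n

data IsState {n : ℕ} : ITL n → Set where
  ⊥′  : IsState ⊥′
  var : ∀ p → IsState (var p)
  _⊃_ : ∀ {A B} → IsState A → IsState B → IsState (A ⊃ B)

State : ℕ → Set
State n = Subset n

-- `finite m x` is the sequence x 0, …, x m of m + 1 states; the values of x
-- beyond m are not part of it, and no definition below depends on them.
data Interval (n : ℕ) : Set where
  finite   : (m : ℕ) (x : ℕ → State n) → Interval n
  infinite : (x : ℕ → State n) → Interval n

module _ {n : ℕ} where

  at : Interval n → ℕ → State n
  at (finite _ x) = x
  at (infinite x) = x

  Position : Interval n → ℕ → Set
  Position (finite m _) k = k ≤ m
  Position (infinite _) _ = ⊤

  Infinite : Interval n → Set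
  Infinite (finite _ _) = ⊥
  Infinite (infinite _) = ⊤

  -- The subinterval from position i to position j, both included.
  sub : Interval n → ℕ → ℕ → Interval n
  sub σ i j = finite (j ∸ i) (at σ ∘ (i +_))

  suffix : Interval n → ℕ → Interval n
  suffix (finite m x) k = finite (m ∸ k) (x ∘ (k +_))
  suffix (infinite x) k = infinite (x ∘ (k +_))

  -- Division points 0 = k 0 < … < k m give m + 1 subintervals, of which the last
  -- one is the suffix from k m; it is infinite when σ is.  Only the values of k
  -- up to m matter.
  record FiniteDivision (P : Interval n → Set) (σ : Interval n) : Set where
    field
      m          : ℕ
      k          : ℕ → ℕ
      start      : k 0 ≡ 0
      increasing : ∀ i → i < m → k i < k (suc i)
      pieces     : ∀ i → i < m → P (sub σ (k i) (k (suc i)))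
      last-two   : Position σ (suc (k m))
      last-piece : P (suffix σ (k m))

  record InfiniteDivision (P : Interval n → Set) (σ : Interval n) : Set where
    field
      σ-infinite : Infinite σ
      k          : ℕ → ℕ
      start      : k 0 ≡ 0
      increasing : ∀ i → k i < k (suc i)
      pieces     : ∀ i → P (sub σ (k i) (k (suc i)))

  infix 4 _⊨_ _⊨ₛ_ _⊨_Π⁻¹_

  _⊨_ : Interval n → ITL n → Set
  σ ⊨ ⊥′    = ⊥
  σ ⊨ var p = p ∈ at σ 0
  σ ⊨ A ⊃ B = σ ⊨ A → σ ⊨ B
  σ ⊨ ○ A   = Position σ 1 × suffix σ 1 ⊨ A
  σ ⊨ A ⨾ B = ∃[ k ] Position σ k × sub σ 0 k ⊨ A × suffix σ k ⊨ B
  σ ⊨ A ✶   = ¬ Position σ 1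
            ⊎ FiniteDivision (λ τ → τ ⊨ A) σ
            ⊎ InfiniteDivision (λ τ → τ ⊨ A) σ

  -- A state satisfies w when the one-state interval consisting of it does.
  _⊨ₛ_ : State n → ITL n → Set
  x ⊨ₛ w = finite 0 (λ _ → x) ⊨ w

  -- σ′|w = σ.  Whether σ′|w is empty, finite or infinite is undecidable for
  -- infinite σ′, so the deletion operation is given by its graph: `pos` lists
  -- in increasing order exactly the positions of σ′ whose states satisfy w, and
  -- σ is the sequence of the states there.  Only the values of `pos` at
  -- positions of σ matter.
  record Restricts (w : ITL n) (σ′ σ : Interval n) : Set where
    field
      pos        : ℕ → ℕ
      position   : ∀ i → Position σ i → Position σ′ (pos i)
      increasing : ∀ i j → i < j → Position σ j → pos i < pos j
      sound      : ∀ i → Position σ i → at σ′ (pos i) ⊨ₛ w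
      complete   : ∀ k → Position σ′ k → at σ′ k ⊨ₛ w →
                   ∃[ i ] Position σ i × pos i ≡ k
      states     : ∀ i → Position σ i → at σ i ≡ at σ′ (pos i)

  _⊨_Π⁻¹_ : Interval n → ITL n → ITL n → Set
  σ ⊨ w Π⁻¹ A = ∃[ σ′ ] Restricts w σ′ σ × σ′ ⊨ A

{-# OPTIONS --safe #-}

-- A property of intervals is recognisable when a map φ from finite words to a
-- finite set, compatible with concatenation, determines it: on a finite interval
-- through the φ-value of its word, on an infinite one through the φ-values of the
-- pieces of any division into finite words.  Recognisable properties are closed
-- under ⊃, ○ and chop (for chop, φ also records the set of φ-values of all pairs
-- of parts) and under images of deletion homomorphisms h (φ records the set of
-- φ-values of all h-preimages).  The latter covers Π⁻¹ and, since h may forget a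
-- propositional variable marking the division points, also A ✶, because "the
-- division points are correct" only needs ⊃, ○ and chop.  Conversely, a
-- recognisable property is definable: Kleene's construction defines the finite
-- words of a given φ-value, and by Ramsey's theorem every infinite word is a
-- word of some value s followed by infinitely many words of one value e, where
-- the pair (s , e) decides membership.
module Submission where

open import Level using (0ℓ)
open import Axiom.ExcludedMiddle using (ExcludedMiddle)
open import Data.Bool.Base using (Bool; true; false)
open import Data.Empty using (⊥)
open import Data.Fin.Base using (Fin; zero; suc; combine; funToFin; finToFun)
open import Data.Fin.Properties using (combine-injectiveˡ; combine-injectiveʳ; finToFun-funToFin)
import Data.Fin.Subset as Subset
open import Data.List.Base using (List; []; _∷_; _++_; [_]; length; applyUpTo; mapMaybe; map; allFin)
open import Data.List.Properties using
  ( length-applyUpTo; map-applyUpTo; map-++; ++-assoc; ++-identityʳ; ++-cancelˡ; length-++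
  ; ∷-injective; ∷-injectiveˡ; ∷-injectiveʳ; ∷ʳ-injective; mapMaybe-++; mapMaybe-map; mapMaybe-just )
open import Data.List.Membership.Propositional using (_∈_)
open import Data.List.Membership.Propositional.Properties using (∈-allFin)
open import Data.List.Relation.Unary.Any using (here; there)
open import Data.Maybe.Base using (Maybe; just; nothing)
open import Data.Maybe.Properties using (just-injective)
open import Data.Nat.Base
open import Data.Nat.Properties
open import Data.Product.Base using (Σ; _×_; _,_; proj₁; proj₂; ∃-syntax)
open import Data.Sum.Base using (_⊎_; inj₁; inj₂)
open import Data.Unit.Base using (⊤; tt)
open import Data.Vec.Base using (Vec; head; tail; lookup; tabulate) renaming (_∷_ to _∷ᵥ_; [] to []ᵥ)
open import Data.Vec.Properties using (tabulate∘lookup; []=⇒lookup; lookup⇒[]=)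
open import Function.Base using (_∘_; id; case_of_)
open import Function.Bundles using (_⇔_; mk⇔; Equivalence)
open import Relation.Binary.Definitions using (tri<; tri≈; tri>)
open import Relation.Binary.PropositionalEquality hiding ([_])
open import Relation.Nullary.Decidable using (Dec; yes; no; does; dec-true)
open import Relation.Nullary.Negation.Core using (¬_; contradiction)
open import Defs

-- `Π⁻¹` asserts the existence of another interval, and this does not commute with the negations
-- contained in `⊃`, so it cannot be pushed through the connectives of A. Recognisability is closed
-- under complement and under existence alike, which is why the argument leaves the syntax and
-- returns to it only once. On infinite intervals, two sequences are compared through their own cut
-- points, with pairwise equal values of the pieces. In this form each closure proof just carries
-- the pieces of one sequence over to the other, and Ramsey's theorem is needed only where a formula
-- has to describe an infinite word by finitely many data. Neighbouring subintervals share a state,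
-- neighbouring factors of a word do not. Chop therefore splits a word at a letter that belongs to
-- both parts, whereas Kleene's construction reads all states of an interval but the last, so that
-- dividing an interval factorises the word that is read. Only the kernel of φ is used, never a
-- product on its values; sets of values become values again as numbers below 2 ^ N, with excluded
-- middle deciding membership.

private variable
  Γ Δ : Set
  n′ n : ℕ


-- Factors of sequences and of lists

applyUpTo-cong : {f g : ℕ → Γ} (m : ℕ) → (∀ i → i < m → f i ≡ g i) →
                 applyUpTo f m ≡ applyUpTo g m
applyUpTo-cong zero    eq = refl
applyUpTo-cong (suc m) eq =
  cong₂ _∷_ (eq 0 z<s) (applyUpTo-cong m (λ i i<m → eq (suc i) (s<s i<m)))

applyUpTo-+ : (f : ℕ → Γ) (m l : ℕ) →
              applyUpTo f (m + l) ≡ applyUpTo f m ++ applyUpTo (f ∘ (m +_)) l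
applyUpTo-+ f zero    l = refl
applyUpTo-+ f (suc m) l = cong (f 0 ∷_) (applyUpTo-+ (f ∘ suc) m l)

applyUpTo-injective : {f g : ℕ → Γ} (m : ℕ) → applyUpTo f m ≡ applyUpTo g m →
                      ∀ i → i < m → f i ≡ g i
applyUpTo-injective (suc m) eq zero    _         = ∷-injectiveˡ eq
applyUpTo-injective (suc m) eq (suc i) (s<s i<m) =
  applyUpTo-injective m (∷-injectiveʳ eq) i i<m

-- The states x i, …, x (j - 1).  Opaque, so that unification can read off i and j.
opaque
  seg : (ℕ → Γ) → ℕ → ℕ → List Γ
  seg x i j = applyUpTo (x ∘ (i +_)) (j ∸ i)

  seg-def : (x : ℕ → Γ) (i j : ℕ) → seg x i j ≡ applyUpTo (x ∘ (i +_)) (j ∸ i)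
  seg-def x i j = refl

opaque
  unfolding seg

  length-seg : (x : ℕ → Γ) (i j : ℕ) → length (seg x i j) ≡ j ∸ i
  length-seg x i j = length-applyUpTo _ (j ∸ i)

  seg-++ : (x : ℕ → Γ) {i j k : ℕ} → i ≤ j → j ≤ k → seg x i j ++ seg x j k ≡ seg x i k
  seg-++ x {i} {j} {k} i≤j j≤k = sym (begin
    applyUpTo (x ∘ (i +_)) (k ∸ i)
      ≡⟨ cong (applyUpTo _) k∸i ⟩
    applyUpTo (x ∘ (i +_)) (j ∸ i + (k ∸ j))
      ≡⟨ applyUpTo-+ _ (j ∸ i) (k ∸ j) ⟩
    seg x i j ++ applyUpTo (x ∘ (i +_) ∘ (j ∸ i +_)) (k ∸ j)
      ≡⟨ cong (seg x i j ++_) (applyUpTo-cong (k ∸ j) λ l _ → cong x (shift l)) ⟩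
    seg x i j ++ seg x j k ∎)
    where
      open ≡-Reasoning
      shift : ∀ l → i + (j ∸ i + l) ≡ j + l
      shift l = trans (sym (+-assoc i (j ∸ i) l)) (cong (_+ l) (m+[n∸m]≡n i≤j))
      k∸i : k ∸ i ≡ j ∸ i + (k ∸ j)
      k∸i = trans (cong (_∸ i) (sym (m+[n∸m]≡n j≤k))) (+-∸-comm (k ∸ j) i≤j)

  seg-cong : {x y : ℕ → Γ} (i j : ℕ) → (∀ k → k < j → x k ≡ y k) → seg x i j ≡ seg y i j
  seg-cong i j eq = applyUpTo-cong (j ∸ i) λ k k<j∸i → eq (i + k) (m<n∸o⇒o+m<n i k<j∸i)
    where
      m<n∸o⇒o+m<n : ∀ {m n} o → m < n ∸ o → o + m < n
      m<n∸o⇒o+m<n {m} {n} zero    lt = lt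
      m<n∸o⇒o+m<n {m} {suc n} (suc o) lt = s<s (m<n∸o⇒o+m<n o lt)

  seg-shift : (x : ℕ → Γ) (p i j : ℕ) → seg (x ∘ (p +_)) i j ≡ seg x (p + i) (p + j)
  seg-shift x p i j = trans
    (applyUpTo-cong (j ∸ i) λ k _ → cong x (sym (+-assoc p i k)))
    (cong (applyUpTo _) (sym ([m+n]∸[m+o]≡n∸o p j i)))

  seg-[] : (x : ℕ → Γ) (i : ℕ) → seg x i i ≡ []
  seg-[] x i = cong (applyUpTo _) (n∸n≡0 i)

  seg-∷ : (x : ℕ → Γ) {i j : ℕ} → i < j → seg x i j ≡ x i ∷ seg x (suc i) j
  seg-∷ x {i} {suc j} (s≤s i≤j) = begin
    applyUpTo (x ∘ (i +_)) (suc j ∸ i)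
      ≡⟨ cong (applyUpTo _) (+-∸-assoc 1 i≤j) ⟩
    x (i + 0) ∷ applyUpTo (x ∘ (i +_) ∘ suc) (j ∸ i)
      ≡⟨ cong₂ _∷_ (cong x (+-identityʳ i)) (applyUpTo-cong (j ∸ i) λ k _ → cong x (+-suc i k)) ⟩
    x i ∷ seg x (suc i) (suc j) ∎
    where open ≡-Reasoning

  seg-[-] : (x : ℕ → Γ) (i : ℕ) → seg x i (suc i) ≡ [ x i ]
  seg-[-] x i = trans (seg-∷ x ≤-refl) (cong (x i ∷_) (seg-[] x (suc i)))

  seg-∷ʳ : (x : ℕ → Γ) {i j : ℕ} → i ≤ j → seg x i (suc j) ≡ seg x i j ++ [ x j ]
  seg-∷ʳ x {i} {j} i≤j =
    trans (sym (seg-++ x i≤j (n≤1+n j))) (cong (seg x i j ++_) (seg-[-] x j))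

-- An occurrence of a letter c in a factor of x; the letter is shared by the
-- two parts, as it is in the chop of an interval.
record SplitAt (x : ℕ → Γ) (i j : ℕ) (p : List Γ) (c : Γ) (s : List Γ) : Set where
  constructor splitAt
  field
    k     : ℕ
    i≤k   : i ≤ k
    k<j   : k < j
    left  : p ++ [ c ] ≡ seg x i (suc k)
    right : c ∷ s ≡ seg x k j

applyUpTo-split : (f : ℕ → Γ) (m : ℕ) (p : List Γ) {c : Γ} {s : List Γ} →
  applyUpTo f m ≡ p ++ c ∷ s →
  length p < m × p ++ [ c ] ≡ applyUpTo f (suc (length p)) ×
  c ∷ s ≡ applyUpTo (f ∘ (length p +_)) (m ∸ length p)
applyUpTo-split f zero    []      ()
applyUpTo-split f zero    (_ ∷ p) ()
applyUpTo-split f (suc m) []      refl = z<s , refl , refl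
applyUpTo-split f (suc m) (a ∷ p) eq with ∷-injective eq
... | refl , eq′ with applyUpTo-split (f ∘ suc) m p eq′
...   | lt , l , r = s<s lt , cong (a ∷_) l , r

seg-split : (x : ℕ → Γ) {i j : ℕ} {p : List Γ} {c : Γ} {s : List Γ} →
            seg x i j ≡ p ++ c ∷ s → SplitAt x i j p c s
seg-split x {i} {j} {p} {c} {s} eq with applyUpTo-split _ (j ∸ i) p (trans (sym (seg-def x i j)) eq)
... | lt , l , r = splitAt (i + length p) (m≤m+n i _) lt′
      (trans l (trans (cong (applyUpTo _) (sym (trans (cong (_∸ i) (sym (+-suc i _))) (m+n∸m≡n i _))))
                      (sym (seg-def x i _))))
      (trans r (trans (applyUpTo-cong _ λ k _ → cong x (sym (+-assoc i (length p) k)))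
                      (trans (cong (applyUpTo _) (∸-+-assoc j i (length p))) (sym (seg-def x _ j)))))
  where
    i<j : i < j
    i<j = m<n∸o⇒m<n lt
      where
        m<n∸o⇒m<n : length p < j ∸ i → i < j
        m<n∸o⇒m<n lt with i <? j
        ... | yes q = q
        ... | no ¬q rewrite m≤n⇒m∸n≡0 (≮⇒≥ ¬q) with () ← lt
    lt′ : i + length p < j
    lt′ = subst (i + length p <_) (m+[n∸m]≡n (<⇒≤ i<j)) (+-monoʳ-< i lt)

-- Levi's lemma for a factorisation with a distinguished letter; for chop it tells which of two
-- concatenated words contains the chopping state.
++-split : (u : List Γ) {v p : List Γ} {c : Γ} {s : List Γ} → u ++ v ≡ p ++ c ∷ s →
  (∃[ s′ ] u ≡ p ++ c ∷ s′ × s ≡ s′ ++ v) ⊎ (∃[ p′ ] p ≡ u ++ p′ × v ≡ p′ ++ c ∷ s)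
++-split []      {p = p} eq = inj₂ (p , refl , eq)
++-split (a ∷ u) {p = []} refl = inj₁ (u , refl , refl)
++-split (a ∷ u) {p = b ∷ p} eq with ∷-injective eq
... | refl , eq′ with ++-split u eq′
...   | inj₁ (s′ , refl , e) = inj₁ (s′ , refl , e)
...   | inj₂ (p′ , refl , e) = inj₂ (p′ , refl , e)

-- Strictly increasing sequences of cut points

record Cuts (k : ℕ → ℕ) : Set where
  constructor cuts
  field
    start      : k 0 ≡ 0
    increasing : ∀ i → k i < k (suc i)

strictly-mono-≤ : {k : ℕ → ℕ} {m : ℕ} → (∀ i → i < m → k i < k (suc i)) →
                  ∀ {i j} → i < j → j ≤ m → k i < k j
strictly-mono-≤ increasing {i} {suc j} (s≤s i≤j) j<m with m≤n⇒m<n∨m≡n i≤j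
... | inj₁ i<j  = <-trans (strictly-mono-≤ increasing i<j (<⇒≤ j<m)) (increasing j j<m)
... | inj₂ refl = increasing j j<m

module _ {k : ℕ → ℕ} (increasing : ∀ i → k i < k (suc i)) where

  strictly-mono : ∀ {i j} → i < j → k i < k j
  strictly-mono i<j = strictly-mono-≤ (λ i _ → increasing i) i<j ≤-refl

  mono : ∀ {i j} → i ≤ j → k i ≤ k j
  mono i≤j with m≤n⇒m<n∨m≡n i≤j
  ... | inj₁ i<j  = <⇒≤ (strictly-mono i<j)
  ... | inj₂ refl = ≤-refl

  expanding : ∀ i → i ≤ k i
  expanding zero    = z≤n
  expanding (suc i) = ≤-<-trans (expanding i) (increasing i)

  strictly-mono⁻¹ : ∀ {i j} → k i < k j → i < j
  strictly-mono⁻¹ {i} {j} lt with i <? j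
  ... | yes i<j = i<j
  ... | no  i≮j = contradiction (mono (≮⇒≥ i≮j)) (<⇒≱ lt)

  -- Since k is strictly increasing, `k (suc p)` exceeds p, so a downward search may start at the
  -- bound `suc p`.
  locate : ∀ {p} → k 0 ≤ p → ∃[ i ] k i ≤ p × p < k (suc i)
  locate {p} k0≤p = go (suc p) (expanding (suc p))
    where
      go : ∀ b → p < k b → ∃[ i ] k i ≤ p × p < k (suc i)
      go zero    p<k0 = contradiction k0≤p (<⇒≱ p<k0)
      go (suc b) p<ksb with k b ≤? p
      ... | yes kb≤p = b , kb≤p , p<ksb
      ... | no  kb≰p = go b (≰⇒> kb≰p)

-- Recognisable properties and their simplest closure laws

-- `comp` says that the kernel of φ is a congruence of the monoid of words. In `fin` and `inf` an
-- implication suffices, because the hypotheses on the two intervals are symmetric.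
record Rec (P : Interval n → Set) : Set where
  field
    size : ℕ
    φ    : List (State n) → Fin size
    comp : ∀ {u u′ v v′} → φ u ≡ φ u′ → φ v ≡ φ v′ → φ (u ++ v) ≡ φ (u′ ++ v′)
    fin  : ∀ {m x m′ x′} → φ (seg x 0 (suc m)) ≡ φ (seg x′ 0 (suc m′)) →
           P (finite m x) → P (finite m′ x′)
    inf  : ∀ {x x′ k k′} → Cuts k → Cuts k′ →
           (∀ i → φ (seg x (k i) (k (suc i))) ≡ φ (seg x′ (k′ i) (k′ (suc i)))) →
           P (infinite x) → P (infinite x′)

  comp-seg : ∀ {x x′ i j k i′ j′ k′} → i ≤ j → j ≤ k → i′ ≤ j′ → j′ ≤ k′ →
             φ (seg x i j) ≡ φ (seg x′ i′ j′) → φ (seg x j k) ≡ φ (seg x′ j′ k′) →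
             φ (seg x i k) ≡ φ (seg x′ i′ k′)
  comp-seg {x} {x′} a b a′ b′ e e′ =
    trans (cong φ (sym (seg-++ x a b))) (trans (comp e e′) (cong φ (seg-++ x′ a′ b′)))

  comp-cuts : ∀ {x x′} {k k′ : ℕ → ℕ} → (∀ i → k i < k (suc i)) → (∀ i → k′ i < k′ (suc i)) →
              (∀ i → φ (seg x (k i) (k (suc i))) ≡ φ (seg x′ (k′ i) (k′ (suc i)))) →
              ∀ i → φ (seg x (k 0) (k i)) ≡ φ (seg x′ (k′ 0) (k′ i))
  comp-cuts {x} {x′} {k} {k′} c c′ eq zero    =
    cong φ (trans (seg-[] x (k 0)) (sym (seg-[] x′ (k′ 0))))
  comp-cuts c c′ eq (suc i) =
    comp-seg (mono c z≤n) (<⇒≤ (c i)) (mono c′ z≤n) (<⇒≤ (c′ i)) (comp-cuts c c′ eq i) (eq i)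

  fin-sub : ∀ {x x′ i j i′ j′} → i ≤ j → i′ ≤ j′ →
            φ (seg x i (suc j)) ≡ φ (seg x′ i′ (suc j′)) →
            P (finite (j ∸ i) (x ∘ (i +_))) → P (finite (j′ ∸ i′) (x′ ∘ (i′ +_)))
  fin-sub {x} {x′} {i} {j} {i′} {j′} le le′ eq =
    fin (trans (cong φ (lemma x le)) (trans eq (cong φ (sym (lemma x′ le′)))))
    where
      lemma : ∀ x {i j} → i ≤ j → seg (x ∘ (i +_)) 0 (suc (j ∸ i)) ≡ seg x i (suc j)
      lemma x {i} {j} le = trans (seg-shift x i 0 _) (cong₂ (seg x) (+-identityʳ i)
        (trans (+-suc i _) (cong suc (m+[n∸m]≡n le))))

  inf-suffix : ∀ {x x′} {k k′ : ℕ → ℕ} → (∀ i → k i < k (suc i)) → (∀ i → k′ i < k′ (suc i)) →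
               (∀ i → φ (seg x (k i) (k (suc i))) ≡ φ (seg x′ (k′ i) (k′ (suc i)))) →
               P (infinite (x ∘ (k 0 +_))) → P (infinite (x′ ∘ (k′ 0 +_)))
  inf-suffix {x} {x′} {k} {k′} c c′ eq =
    inf (shifted c) (shifted c′) λ i → trans (cong φ (piece x c i)) (trans (eq i) (cong φ (sym (piece x′ c′ i))))
    where
      shifted : ∀ {k : ℕ → ℕ} → (∀ i → k i < k (suc i)) → Cuts (λ i → k i ∸ k 0)
      shifted {k} c = cuts (n∸n≡0 (k 0)) (λ i → ∸-monoˡ-< (c i) (mono c z≤n))
      piece : ∀ x {k : ℕ → ℕ} → (∀ i → k i < k (suc i)) → ∀ i →
              seg (x ∘ (k 0 +_)) (k i ∸ k 0) (k (suc i) ∸ k 0) ≡ seg x (k i) (k (suc i))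
      piece x {k} c i = trans (seg-shift x (k 0) _ _)
        (cong₂ (seg x) (m+[n∸m]≡n (mono c z≤n)) (m+[n∸m]≡n (mono c z≤n)))

  -- Intervals that agree state by state need not be propositionally equal, and a finite one carries
  -- arbitrary values beyond its end. A recognisable property cannot tell them apart, because φ sees
  -- only the states listed by `seg`.
  fin-cong : ∀ {m m′ x x′} → m ≡ m′ → (∀ i → i ≤ m → x i ≡ x′ i) → P (finite m x) → P (finite m′ x′)
  fin-cong {m} refl eq = fin (cong φ (seg-cong 0 (suc m) λ k k<sm → eq k (s≤s⁻¹ k<sm)))

  inf-cong : ∀ {x x′} → (∀ i → x i ≡ x′ i) → P (infinite x) → P (infinite x′)
  inf-cong eq = inf (cuts refl (λ _ → ≤-refl)) (cuts refl (λ _ → ≤-refl)) λ i →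
    cong φ (seg-cong i (suc i) λ k _ → eq k)

open Rec

rec-⇔ : {P Q : Interval n → Set} → (∀ σ → P σ ⇔ Q σ) → Rec P → Rec Q
rec-⇔ P⇔Q R = record
  { size = size R
  ; φ    = φ R
  ; comp = comp R
  ; fin  = λ eq q → Equivalence.to (P⇔Q _) (fin R eq (Equivalence.from (P⇔Q _) q))
  ; inf  = λ c c′ eq q → Equivalence.to (P⇔Q _) (inf R c c′ eq (Equivalence.from (P⇔Q _) q))
  }

rec-const : (C : Set) → Rec {n} (λ _ → C)
rec-const C = record
  { size = 1 ; φ = λ _ → zero ; comp = λ _ _ → refl ; fin = λ _ c → c ; inf = λ _ _ _ c → c }

rec-⊃ : {P Q : Interval n → Set} → Rec P → Rec Q → Rec (λ σ → P σ → Q σ)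
rec-⊃ RP RQ = record
  { size = size RP * size RQ
  ; φ    = λ u → combine (φ RP u) (φ RQ u)
  ; comp = λ e e′ → cong₂ combine (comp RP (left e) (left e′)) (comp RQ (right e) (right e′))
  ; fin  = λ e f p → fin RQ (right e) (f (fin RP (sym (left e)) p))
  ; inf  = λ c c′ e f p → inf RQ c c′ (right ∘ e) (f (inf RP c′ c (sym ∘ left ∘ e) p))
  }
  where
    left : ∀ {u v} → combine (φ RP u) (φ RQ u) ≡ combine (φ RP v) (φ RQ v) → φ RP u ≡ φ RP v
    left = combine-injectiveˡ _ _ _ _
    right : ∀ {u v} → combine (φ RP u) (φ RQ u) ≡ combine (φ RP v) (φ RQ v) → φ RQ u ≡ φ RQ v
    right {u} {v} = combine-injectiveʳ (φ RP u) (φ RQ u) (φ RP v) (φ RQ v)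

-- Chopping off an interval of two states is the next operator, so that `○` reduces to chop.
Two : Interval n → Set
Two (finite m _) = m ≡ 1
Two (infinite _) = ⊥

-- The four values are the lengths 0, 1, 2 and "at least 3", with addition capped at 3.
rec-Two : Rec {n} Two
rec-Two {n} = record
  { size = 4
  ; φ    = count
  ; comp = λ {u} {u′} {v} {v′} e e′ →
      trans (count-++ u v) (trans (cong₂ add e e′) (sym (count-++ u′ v′)))
  ; fin  = λ {m} {x} {m′} {x′} e → λ { refl → two {m′} {x} {x′} e }
  ; inf  = λ _ _ _ ()
  }
  where
    count : List (State n) → Fin 4
    count []              = zero
    count (_ ∷ [])        = suc zero
    count (_ ∷ _ ∷ [])    = suc (suc zero)
    count (_ ∷ _ ∷ _ ∷ _) = suc (suc (suc zero))
    succ : Fin 4 → Fin 4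
    succ zero                   = suc zero
    succ (suc zero)             = suc (suc zero)
    succ (suc (suc _))          = suc (suc (suc zero))
    add : Fin 4 → Fin 4 → Fin 4
    add zero                   j = j
    add (suc zero)             j = succ j
    add (suc (suc zero))       j = succ (succ j)
    add (suc (suc (suc zero))) j = suc (suc (suc zero))
    count-++ : ∀ u v → count (u ++ v) ≡ add (count u) (count v)
    count-++ []              v               = refl
    count-++ (_ ∷ [])        []              = refl
    count-++ (_ ∷ [])        (_ ∷ [])        = refl
    count-++ (_ ∷ [])        (_ ∷ _ ∷ [])    = refl
    count-++ (_ ∷ [])        (_ ∷ _ ∷ _ ∷ _) = refl
    count-++ (_ ∷ _ ∷ [])    []              = refl
    count-++ (_ ∷ _ ∷ [])    (_ ∷ [])        = refl
    count-++ (_ ∷ _ ∷ [])    (_ ∷ _ ∷ [])    = refl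
    count-++ (_ ∷ _ ∷ [])    (_ ∷ _ ∷ _ ∷ _) = refl
    count-++ (_ ∷ _ ∷ _ ∷ _) v               = refl
    two : ∀ {m x x′} → count (seg x 0 2) ≡ count (seg x′ 0 (suc m)) → m ≡ 1
    two {m} {x} {x′} e
      with trans (cong count (sym (seg-def x 0 2))) (trans e (cong count (seg-def x′ 0 (suc m))))
    two {suc zero}    e | _ = refl
    two {zero}        e | ()
    two {suc (suc m)} e | ()

Chop : (P Q : Interval n → Set) → Interval n → Set
Chop P Q σ = ∃[ k ] Position σ k × P (sub σ 0 k) × Q (suffix σ k)

seg-++⁻ : (x : ℕ → Γ) {i j : ℕ} → i ≤ j → (u : List Γ) {v : List Γ} → seg x i j ≡ u ++ v →
          ∃[ k ] i ≤ k × k ≤ j × u ≡ seg x i k × v ≡ seg x k j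
seg-++⁻ x {i} {j} i≤j u {[]}    eq =
  j , i≤j , ≤-refl , trans (sym (++-identityʳ u)) (sym eq) , sym (seg-[] x j)
seg-++⁻ x {i} {j} i≤j u {c ∷ s} eq with seg-split x {i} {j} {u} eq
... | splitAt k i≤k k<j l r =
      k , i≤k , <⇒≤ k<j , proj₁ (∷ʳ-injective u _ (trans l (seg-∷ʳ x i≤k))) , r

-- Sequences built from finite words, and letter-to-letter maps

nth : Γ → List Γ → ℕ → Γ
nth d []      _       = d
nth d (a ∷ u) zero    = a
nth d (a ∷ u) (suc k) = nth d u k

nth-++ : (d : Γ) (u : List Γ) {v : List Γ} {k : ℕ} → k < length u → nth d (u ++ v) k ≡ nth d u k
nth-++ d (a ∷ u) {k = zero}  _         = refl
nth-++ d (a ∷ u) {k = suc k} (s<s k<u) = nth-++ d u k<u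

applyUpTo-nth : (d : Γ) (u : List Γ) → applyUpTo (nth d u) (length u) ≡ u
applyUpTo-nth d []      = refl
applyUpTo-nth d (a ∷ u) = cong (a ∷_) (applyUpTo-nth d u)

seg-nth : (d : Γ) (u : List Γ) → seg (nth d u) 0 (length u) ≡ u
seg-nth d u = trans (seg-def (nth d u) 0 (length u)) (applyUpTo-nth d u)

seg-map : (f : Γ → Δ) (x : ℕ → Γ) (i j : ℕ) → map f (seg x i j) ≡ seg (f ∘ x) i j
seg-map f x i j = trans (cong (map f) (seg-def x i j))
  (trans (map-applyUpTo _ f (j ∸ i)) (sym (seg-def (f ∘ x) i j)))

module Flatten (d : Γ) (us : ℕ → List Γ) (nonempty : ∀ i → 0 < length (us i)) where

  pre : ℕ → List Γ
  pre zero    = []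
  pre (suc i) = pre i ++ us i

  cut : ℕ → ℕ
  cut i = length (pre i)

  -- The words are nonempty, so the first `suc k` of them together are longer than k, and the
  -- default `d` is never reached.
  flat : ℕ → Γ
  flat k = nth d (pre (suc k)) k

  cut-increasing : ∀ i → cut i < cut (suc i)
  cut-increasing i = subst (cut i <_) (sym (length-++ (pre i)))
    (m<m+n (cut i) (nonempty i))

  cut-cuts : Cuts cut
  cut-cuts = cuts refl cut-increasing

  pre-prefix : ∀ {i j} → i ≤ j → ∃[ v ] pre j ≡ pre i ++ v
  pre-prefix {i} {j} i≤j with m≤n⇒m<n∨m≡n i≤j
  ... | inj₂ refl = [] , sym (++-identityʳ (pre i))
  pre-prefix {i} {suc j} i≤j | inj₁ (s≤s i≤j′) with pre-prefix i≤j′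
  ... | v , eq = v ++ us j , trans (cong (_++ us j) eq) (++-assoc (pre i) v (us j))

  nth-pre : ∀ {i j k} → i ≤ j → k < cut i → nth d (pre j) k ≡ nth d (pre i) k
  nth-pre {i} {j} {k} i≤j k< with pre-prefix i≤j
  ... | v , eq = trans (cong (λ u → nth d u k) eq) (nth-++ d (pre i) k<)

  flat-nth : ∀ i k → k < cut i → flat k ≡ nth d (pre i) k
  flat-nth i k k< with ≤-total i (suc k)
  ... | inj₁ i≤sk = nth-pre i≤sk k<
  ... | inj₂ sk≤i = sym (nth-pre sk≤i (expanding cut-increasing (suc k)))

  seg-flat₀ : ∀ i → seg flat 0 (cut i) ≡ pre i
  seg-flat₀ i = trans (seg-cong 0 (cut i) (flat-nth i)) (seg-nth d (pre i))

  seg-flat : ∀ i → seg flat (cut i) (cut (suc i)) ≡ us i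
  seg-flat i = ++-cancelˡ (pre i) _ _ (begin
    pre i ++ seg flat (cut i) (cut (suc i))
      ≡⟨ cong (_++ seg flat (cut i) (cut (suc i))) (sym (seg-flat₀ i)) ⟩
    seg flat 0 (cut i) ++ seg flat (cut i) (cut (suc i))
      ≡⟨ seg-++ flat z≤n (<⇒≤ (cut-increasing i)) ⟩
    seg flat 0 (cut (suc i))
      ≡⟨ seg-flat₀ (suc i) ⟩
    pre (suc i) ∎)
    where open ≡-Reasoning

mapI : (State n′ → State n) → Interval n′ → Interval n
mapI f (finite k x) = finite k (f ∘ x)
mapI f (infinite x) = infinite (f ∘ x)

rec-mapI : (f : State n′ → State n) {P : Interval n → Set} → Rec P → Rec (P ∘ mapI f)
rec-mapI f R = record
  { size = size R
  ; φ    = φ R ∘ map f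
  ; comp = λ {u} {u′} {v} {v′} e e′ → trans (cong (φ R) (map-++ f u v))
             (trans (comp R e e′) (cong (φ R) (sym (map-++ f u′ v′))))
  ; fin  = λ {m} {x} {m′} {x′} e → fin R (trans (cong (φ R) (sym (seg-map f x 0 (suc m))))
             (trans e (cong (φ R) (seg-map f x′ 0 (suc m′)))))
  ; inf  = λ {x} {x′} {k} {k′} c c′ e → inf R c c′ λ i →
             trans (cong (φ R) (sym (seg-map f x (k i) (k (suc i)))))
             (trans (e i) (cong (φ R) (seg-map f x′ (k′ i) (k′ (suc i)))))
  }

-- Deletion homomorphisms on words

module _ (h : Γ → Maybe Δ) where

  -- The cut in `w` is not unique, as deleted letters may go to either side; the recursion cuts as
  -- early as possible.
  mapMaybe-++⁻ : (w : List Γ) (u : List Δ) {v : List Δ} → mapMaybe h w ≡ u ++ v →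
    ∃[ w₁ ] ∃[ w₂ ] w ≡ w₁ ++ w₂ × mapMaybe h w₁ ≡ u × mapMaybe h w₂ ≡ v
  mapMaybe-++⁻ w []      eq = [] , w , refl , refl , eq
  mapMaybe-++⁻ (a ∷ w) (b ∷ u) eq with h a in ha
  ... | nothing with mapMaybe-++⁻ w (b ∷ u) eq
  ...   | w₁ , w₂ , refl , e₁ , e₂ = a ∷ w₁ , w₂ , refl , e , e₂
    where
      e : mapMaybe h (a ∷ w₁) ≡ b ∷ u
      e rewrite ha = e₁
  mapMaybe-++⁻ (a ∷ w) (b ∷ u) eq | just c with ∷-injective eq
  ... | refl , eq′ with mapMaybe-++⁻ w u eq′
  ...   | w₁ , w₂ , refl , e₁ , e₂ = a ∷ w₁ , w₂ , refl , e , e₂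
    where
      e : mapMaybe h (a ∷ w₁) ≡ b ∷ u
      e rewrite ha = cong (b ∷_) e₁

  mapMaybe-∷⁻ : (w : List Γ) {c : Δ} {s : List Δ} → mapMaybe h w ≡ c ∷ s →
    ∃[ w₁ ] ∃[ a ] ∃[ w₂ ] w ≡ w₁ ++ a ∷ w₂ × mapMaybe h w₁ ≡ [] × h a ≡ just c
  mapMaybe-∷⁻ (a ∷ w) eq with h a in ha
  ... | just b with ∷-injective eq
  ...   | refl , _ = [] , a , w , refl , refl , ha
  mapMaybe-∷⁻ (a ∷ w) eq | nothing with mapMaybe-∷⁻ w eq
  ...   | w₁ , b , w₂ , refl , e , hb = a ∷ w₁ , b , w₂ , refl , e′ , hb
    where
      e′ : mapMaybe h (a ∷ w₁) ≡ []
      e′ rewrite ha = e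

  mapMaybe-length-> : (w : List Γ) {u : List Δ} → mapMaybe h w ≡ u → 0 < length u → 0 < length w
  mapMaybe-length-> []      refl ()
  mapMaybe-length-> (_ ∷ _) _    _ = z<s

  module _ (x : ℕ → Γ) where

    mapMaybe-seg-++ : ∀ {i j k} → i ≤ j → j ≤ k →
      mapMaybe h (seg x i k) ≡ mapMaybe h (seg x i j) ++ mapMaybe h (seg x j k)
    mapMaybe-seg-++ {i} {j} {k} i≤j j≤k =
      trans (cong (mapMaybe h) (sym (seg-++ x i≤j j≤k))) (mapMaybe-++ h (seg x i j) (seg x j k))

    mapMaybe-seg-++⁻ : ∀ {i j} → i ≤ j → (u : List Δ) {v : List Δ} →
      mapMaybe h (seg x i j) ≡ u ++ v →
      ∃[ k ] i ≤ k × k ≤ j × mapMaybe h (seg x i k) ≡ u × mapMaybe h (seg x k j) ≡ v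
    mapMaybe-seg-++⁻ {i} {j} i≤j u eq with mapMaybe-++⁻ (seg x i j) u eq
    ... | w₁ , w₂ , e , e₁ , e₂ with seg-++⁻ x i≤j w₁ e
    ...   | k , i≤k , k≤j , refl , refl = k , i≤k , k≤j , e₁ , e₂

    -- When the state at i survives the deletion, this number is its index in the image.
    kept : ℕ → ℕ
    kept i = length (mapMaybe h (seg x 0 i))

    kept-mono : ∀ {i j} → i ≤ j → kept i ≤ kept j
    kept-mono {i} {j} i≤j = begin
      kept i ≤⟨ m≤m+n (kept i) _ ⟩
      kept i + length (mapMaybe h (seg x i j))
        ≡⟨ sym (length-++ (mapMaybe h (seg x 0 i))) ⟩
      length (mapMaybe h (seg x 0 i) ++ mapMaybe h (seg x i j))
        ≡⟨ cong length (sym (mapMaybe-seg-++ z≤n i≤j)) ⟩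
      kept j ∎
      where open ≤-Reasoning

    kept-<⁻¹ : ∀ {i j} → kept i < kept j → i < j
    kept-<⁻¹ {i} {j} lt with i <? j
    ... | yes i<j = i<j
    ... | no  i≮j = contradiction (kept-mono (≮⇒≥ i≮j)) (<⇒≱ lt)

    mapMaybe-seg-suc : ∀ {i} {c : Δ} → h (x i) ≡ just c →
      mapMaybe h (seg x 0 (suc i)) ≡ mapMaybe h (seg x 0 i) ++ [ c ]
    mapMaybe-seg-suc {i} {c} hx = begin
      mapMaybe h (seg x 0 (suc i))              ≡⟨ cong (mapMaybe h) (seg-∷ʳ x z≤n) ⟩
      mapMaybe h (seg x 0 i ++ [ x i ])         ≡⟨ mapMaybe-++ h (seg x 0 i) [ x i ] ⟩
      mapMaybe h (seg x 0 i) ++ mapMaybe h [ x i ] ≡⟨ cong (mapMaybe h (seg x 0 i) ++_) single ⟩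
      mapMaybe h (seg x 0 i) ++ [ c ]           ∎
      where
        open ≡-Reasoning
        single : mapMaybe h [ x i ] ≡ [ c ]
        single rewrite hx = refl

    kept-suc : ∀ {i} {c : Δ} → h (x i) ≡ just c → kept (suc i) ≡ suc (kept i)
    kept-suc {i} hx = trans (cong length (mapMaybe-seg-suc hx))
      (trans (length-++ (mapMaybe h (seg x 0 i))) (+-comm (kept i) 1))

    mapMaybe-none : ∀ {i j} → i ≤ j → (∀ k → i ≤ k → k < j → h (x k) ≡ nothing) →
                    mapMaybe h (seg x i j) ≡ []
    mapMaybe-none {i} {j} i≤j none with m≤n⇒m<n∨m≡n i≤j
    ... | inj₂ refl = cong (mapMaybe h) (seg-[] x i)
    mapMaybe-none {i} {suc j} _ none | inj₁ (s≤s i≤j) = begin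
      mapMaybe h (seg x i (suc j))                 ≡⟨ cong (mapMaybe h) (seg-∷ʳ x i≤j) ⟩
      mapMaybe h (seg x i j ++ [ x j ])            ≡⟨ mapMaybe-++ h (seg x i j) [ x j ] ⟩
      mapMaybe h (seg x i j) ++ mapMaybe h [ x j ] ≡⟨ cong₂ _++_
        (mapMaybe-none i≤j λ k i≤k k<j → none k i≤k (m<n⇒m<1+n k<j)) single ⟩
      []                                           ∎
      where
        open ≡-Reasoning
        single : mapMaybe h [ x j ] ≡ []
        single rewrite none j i≤j ≤-refl = refl

    mapMaybe-letter : ∀ {j} (u : List Δ) {c : Δ} → mapMaybe h (seg x 0 j) ≡ u ++ [ c ] →
      ∃[ k ] k < j × mapMaybe h (seg x 0 k) ≡ u × h (x k) ≡ just c
    mapMaybe-letter {j} u eq with mapMaybe-seg-++⁻ z≤n u eq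
    ... | k , _ , k≤j , e₁ , e₂ with mapMaybe-∷⁻ (seg x k j) e₂
    ...   | w₁ , a , w₂ , e , e₃ , ha with seg-split x {k} {j} {w₁} e
    ...     | splitAt l k≤l l<j left right with ∷ʳ-injective w₁ _ (trans left (seg-∷ʳ x k≤l))
    ...       | refl , refl = l , l<j ,
                trans (mapMaybe-seg-++ z≤n k≤l) (trans (cong₂ _++_ e₁ e₃) (++-identityʳ u)) , ha

-- A finite interval may arise from an infinite one with finitely many surviving states.
Im : (State n′ → Maybe (State n)) → (Interval n′ → Set) → Interval n → Set
Im h P (finite m x) =
  (∃[ m′ ] ∃[ x′ ] mapMaybe h (seg x′ 0 (suc m′)) ≡ seg x 0 (suc m) × P (finite m′ x′)) ⊎
  (∃[ x′ ] ∃[ l ] mapMaybe h (seg x′ 0 l) ≡ seg x 0 (suc m) ×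
     (∀ k → l ≤ k → h (x′ k) ≡ nothing) × P (infinite x′))
Im h P (infinite x) =
  ∃[ x′ ] (∀ i → ∃[ l ] mapMaybe h (seg x′ 0 l) ≡ seg x 0 i) × P (infinite x′)

-- Properties of intervals that express divisions

default : State n
default = Subset.⊥

-- μ is the set of division points; the end of σ is not one of them.
record Marked (P : Interval n → Set) (σ : Interval n) (μ : ℕ → Set) : Set where
  field
    start       : μ 0
    consecutive : ∀ i j → i < j → Position σ j → μ i → μ j →
                  (∀ k → i < k → k < j → ¬ μ k) → P (sub σ i j)
    last        : ∀ i → Position σ i → μ i → (∀ k → i < k → Position σ k → ¬ μ k) →
                  Position σ (suc i) × P (suffix σ i)

Marks : (Interval n → Set) → Interval n → Set
Marks P σ = Σ (ℕ → Bool) λ b → Marked P σ (λ i → b i ≡ true)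

Next : (Interval n → Set) → Interval n → Set
Next P σ = Position σ 1 × P (suffix σ 1)

Ever : (Interval n → Set) → Interval n → Set
Ever = Chop (λ _ → ⊤)

infixr 7 _∩_
infix  8 ∁_

_∩_ : (P Q : Interval n → Set) → Interval n → Set
(P ∩ Q) σ = P σ × Q σ

∁_ : (Interval n → Set) → Interval n → Set
(∁ P) σ = ¬ P σ

All : Interval n → Set
All _ = ⊤

Position-0 : (σ : Interval n) → Position σ 0
Position-0 (finite _ _) = z≤n
Position-0 (infinite _) = tt

Position-suffix : (σ : Interval n) {i l : ℕ} → Position σ (i + l) → Position (suffix σ i) l
Position-suffix (finite m _) {i} {l} le = subst (_≤ m ∸ i) (m+n∸m≡n i l) (∸-monoˡ-≤ i le)
Position-suffix (infinite _) _  = tt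

Position-suffix⁻ : (σ : Interval n) {i l : ℕ} → Position σ i → Position (suffix σ i) l → Position σ (i + l)
Position-suffix⁻ (finite m _) {i} {l} i≤m l≤ = subst (i + l ≤_) (m+[n∸m]≡n i≤m) (+-monoʳ-≤ i l≤)
Position-suffix⁻ (infinite _) _ _ = tt

at-suffix : (σ : Interval n) (i k : ℕ) → at (suffix σ i) k ≡ at σ (i + k)
at-suffix (finite _ _) i k = refl
at-suffix (infinite _) i k = refl

sub-suffix : (σ : Interval n) (i l : ℕ) → sub (suffix σ i) 0 l ≡ finite l (at σ ∘ (i +_))
sub-suffix (finite _ _) i l = refl
sub-suffix (infinite _) i l = refl

-- Abbreviations for formulas

⊤′ : ITL n
⊤′ = ⊥′ ⊃ ⊥′

infix  6.5 ¬′_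
infixr 6 _∧′_
infixr 5 _∨′_

¬′_ : ITL n → ITL n
¬′ A = A ⊃ ⊥′

_∧′_ _∨′_ : ITL n → ITL n → ITL n
A ∧′ B = ¬′ (A ⊃ ¬′ B)
A ∨′ B = ¬′ A ⊃ B

⋁ : ∀ {N} → (Fin N → ITL n) → ITL n
⋁ {N = zero}  f = ⊥′
⋁ {N = suc N} f = f zero ∨′ ⋁ (f ∘ suc)

single : ITL n
single = ¬′ ○ ⊤′

-- Finite codes for sets of values

module Classical (em : ExcludedMiddle 0ℓ) where

  stable : {A : Set} → ¬ ¬ A → A
  stable {A} ¬¬a with em {A}
  ... | yes a = a
  ... | no ¬a = contradiction ¬a ¬¬a

  bit : Set → Fin 2
  bit A with em {A}
  ... | yes _ = suc zero
  ... | no  _ = zero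

  bit-⇒ : {A B : Set} → bit A ≡ bit B → A → B
  bit-⇒ {A} {B} eq a with em {A} | em {B}
  ... | yes _ | yes b = b
  ... | no ¬a | _     = contradiction a ¬a
  bit-⇒ () a | yes _ | no _

  bit-cong : {A B : Set} → (A → B) → (B → A) → bit A ≡ bit B
  bit-cong {A} {B} f g with em {A} | em {B}
  ... | yes _ | yes _ = refl
  ... | no  _ | no  _ = refl
  ... | yes a | no ¬b = contradiction (f a) ¬b
  ... | no ¬a | yes b = contradiction (g b) ¬a

  -- The characteristic function of a subset of `Fin N`, read as a binary number. It turns
  -- extensional equality of subsets into equality of numbers, so a set of values can serve as a
  -- value of a new φ.
  code : ∀ {N} → (Fin N → Set) → Fin (2 ^ N)
  code P = funToFin (λ i → bit (P i))

  code-⇒ : ∀ {N} {P Q : Fin N → Set} → code P ≡ code Q → ∀ i → P i → Q i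
  code-⇒ {P = P} {Q} eq i = bit-⇒
    (trans (sym (finToFun-funToFin (bit ∘ P) i))
           (trans (cong (λ t → finToFun t i) eq) (finToFun-funToFin (bit ∘ Q) i)))

  code-cong : ∀ {N} {P Q : Fin N → Set} → (∀ i → P i → Q i) → (∀ i → Q i → P i) →
              code P ≡ code Q
  code-cong {zero}  f g = refl
  code-cong {suc N} f g =
    cong₂ combine (bit-cong (f zero) (g zero)) (code-cong (f ∘ suc) (g ∘ suc))

  -- The third value is for the empty word: in a concatenation it leaves the first letter to the
  -- other factor.
  rec-head : (Q : State n → Set) → Rec (λ σ → Q (at σ 0))
  rec-head {n} Q = record
    { size = 3
    ; φ    = first
    ; comp = λ {u} {u′} {v} {v′} e e′ →
        trans (first-++ u v) (trans (cong₂ orElse e e′) (sym (first-++ u′ v′)))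
    ; fin  = λ {m} {x} {m′} {x′} e → bit-⇒ (suc-inj
        (trans (sym (first-seg x {0} {suc m} z<s)) (trans e (first-seg x′ {0} {suc m′} z<s))))
    ; inf  = λ {x} {x′} c c′ e → bit-⇒ (suc-inj
        (trans (sym (first-cut x c)) (trans (e 0) (first-cut x′ c′))))
    }
    where
      suc-inj : {i j : Fin 2} → _≡_ {A = Fin 3} (suc i) (suc j) → i ≡ j
      suc-inj refl = refl
      first : List (State n) → Fin 3
      first []      = zero
      first (a ∷ _) = suc (bit (Q a))
      orElse : Fin 3 → Fin 3 → Fin 3
      orElse zero    j = j
      orElse (suc i) _ = suc i
      first-++ : ∀ u v → first (u ++ v) ≡ orElse (first u) (first v)
      first-++ []      v = refl
      first-++ (_ ∷ _) v = refl
      first-seg : ∀ x {i j} → i < j → first (seg x i j) ≡ suc (bit (Q (x i)))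
      first-seg x i<j = cong first (seg-∷ x i<j)
      first-cut : ∀ x {k} → Cuts k → first (seg x (k 0) (k 1)) ≡ suc (bit (Q (x 0)))
      first-cut x (cuts start inc) = trans (first-seg x (inc 0)) (cong (suc ∘ bit ∘ Q ∘ x) start)

  -- Closure under chop

  module _ {P Q : Interval n → Set} (RP : Rec P) (RQ : Rec Q) where

    private
      Splits : List (State n) → Fin (size RP * size RQ) → Set
      Splits u t = ∃[ p ] ∃[ c ] ∃[ s ]
        u ≡ p ++ c ∷ s × combine (φ RP (p ++ [ c ])) (φ RQ (c ∷ s)) ≡ t

      -- The values of the whole word are kept next to the set of splits: a split of a concatenation
      -- falls in one of the two words, and the other word contributes its whole value to one of the
      -- two parts.
      ψ : List (State n) → Fin (size RP * (size RQ * 2 ^ (size RP * size RQ)))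
      ψ u = combine (φ RP u) (combine (φ RQ u) (code (Splits u)))

      ψ-P : ∀ {u v} → ψ u ≡ ψ v → φ RP u ≡ φ RP v
      ψ-P = combine-injectiveˡ _ _ _ _

      ψ-rest : ∀ {u v} → ψ u ≡ ψ v →
               combine (φ RQ u) (code (Splits u)) ≡ combine (φ RQ v) (code (Splits v))
      ψ-rest {u} {v} = combine-injectiveʳ (φ RP u) _ (φ RP v) _

      ψ-Q : ∀ {u v} → ψ u ≡ ψ v → φ RQ u ≡ φ RQ v
      ψ-Q {u} {v} e = combine-injectiveˡ (φ RQ u) (code (Splits u)) (φ RQ v) (code (Splits v)) (ψ-rest {u} {v} e)

      ψ-Splits : ∀ {u v} → ψ u ≡ ψ v → ∀ t → Splits u t → Splits v t
      ψ-Splits {u} {v} e = code-⇒ (combine-injectiveʳ (φ RQ u) _ (φ RQ v) _ (ψ-rest {u} {v} e))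

      ψ-split : ∀ {u v p c s} → ψ u ≡ ψ v → u ≡ p ++ c ∷ s →
                ∃[ p′ ] ∃[ c′ ] ∃[ s′ ] v ≡ p′ ++ c′ ∷ s′ ×
                φ RP (p′ ++ [ c′ ]) ≡ φ RP (p ++ [ c ]) × φ RQ (c′ ∷ s′) ≡ φ RQ (c ∷ s)
      ψ-split {u} {v} {p} {c} {s} e refl with ψ-Splits {u} {v} e _ (p , c , s , refl , refl)
      ... | p′ , c′ , s′ , refl , t = p′ , c′ , s′ , refl ,
            combine-injectiveˡ (φ RP (p′ ++ [ c′ ])) (φ RQ (c′ ∷ s′)) _ _ t ,
            combine-injectiveʳ (φ RP (p′ ++ [ c′ ])) (φ RQ (c′ ∷ s′)) (φ RP (p ++ [ c ])) _ t

      ψ-comp : ∀ {u u′ v v′} → ψ u ≡ ψ u′ → ψ v ≡ ψ v′ →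
               ∀ t → Splits (u ++ v) t → Splits (u′ ++ v′) t
      ψ-comp {u} {u′} {v} {v′} e e′ t (p , c , s , eq , refl) with ++-split u eq
      ... | inj₁ (s₁ , eq₁ , refl) with ψ-split {u} {u′} e eq₁
      ...   | p′ , c′ , s′ , refl , a , b =
              p′ , c′ , s′ ++ v′ , ++-assoc p′ (c′ ∷ s′) v′ ,
              cong₂ combine a (comp RQ b (sym (ψ-Q {v} {v′} e′)))
      ψ-comp {u} {u′} {v} {v′} e e′ t (p , c , s , eq , refl) | inj₂ (p₁ , refl , eq₁)
        with ψ-split {v} {v′} e′ eq₁
      ...   | p′ , c′ , s′ , refl , a , b =
              u′ ++ p′ , c′ , s′ , sym (++-assoc u′ p′ (c′ ∷ s′)) ,
              cong₂ combine (trans (cong (φ RP) (++-assoc u′ p′ [ c′ ]))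
                              (trans (comp RP (sym (ψ-P {u} {u′} e)) a)
                                     (cong (φ RP) (sym (++-assoc u p₁ [ c ]))))) b

      ψ-seg : ∀ {x x′ i j i′ j′ k} → ψ (seg x i j) ≡ ψ (seg x′ i′ j′) → i ≤ k → k < j →
              ∃[ k′ ] i′ ≤ k′ × k′ < j′ × φ RP (seg x i (suc k)) ≡ φ RP (seg x′ i′ (suc k′)) ×
              φ RQ (seg x k j) ≡ φ RQ (seg x′ k′ j′)
      ψ-seg {x} {x′} {i} {j} {i′} {j′} {k} e i≤k k<j
        with ψ-split {seg x i j} {seg x′ i′ j′} e
               (trans (sym (seg-++ x i≤k (<⇒≤ k<j))) (cong (seg x i k ++_) (seg-∷ x k<j)))
      ... | p′ , c′ , s′ , eq , a , b with seg-split x′ {i′} {j′} eq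
      ...   | splitAt k′ i′≤k′ k′<j′ l r = k′ , i′≤k′ , k′<j′ ,
              trans (cong (φ RP) (seg-∷ʳ x i≤k)) (trans (sym a) (cong (φ RP) l)) ,
              trans (cong (φ RQ) (seg-∷ x k<j)) (trans (sym b) (cong (φ RQ) r))

    rec-Chop : Rec (Chop P Q)
    rec-Chop = record
      { size = _
      ; φ    = ψ
      ; comp = λ {u} {u′} {v} {v′} e e′ →
          cong₂ combine (comp RP (ψ-P {u} {u′} e) (ψ-P {v} {v′} e′))
            (cong₂ combine (comp RQ (ψ-Q {u} {u′} e) (ψ-Q {v} {v′} e′))
              (code-cong (ψ-comp {u} {u′} {v} {v′} e e′)
                         (ψ-comp {u′} {u} {v′} {v} (sym e) (sym e′))))
      ; fin  = chop-fin
      ; inf  = chop-inf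
      }
      where
        chop-fin : ∀ {m x m′ x′} → ψ (seg x 0 (suc m)) ≡ ψ (seg x′ 0 (suc m′)) →
                   Chop P Q (finite m x) → Chop P Q (finite m′ x′)
        chop-fin {m} {x} {m′} {x′} e (k , k≤m , p , q)
          with ψ-seg {x} {x′} {0} {suc m} {0} {suc m′} e z≤n (s≤s k≤m)
        ... | k′ , _ , k′<m′ , a , b =
              k′ , s≤s⁻¹ k′<m′ , fin RP {k} {x} {k′} {x′} a p , fin-sub RQ k≤m (s≤s⁻¹ k′<m′) b q

        -- Only the piece that contains the chopping position is split anew. The pieces before it
        -- join its left part in one finite word; its right part, followed by the later pieces, is
        -- the division of the suffix described by `rest`.
        chop-inf : ∀ {x x′ k k′} → Cuts k → Cuts k′ →
                   (∀ i → ψ (seg x (k i) (k (suc i))) ≡ ψ (seg x′ (k′ i) (k′ (suc i)))) →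
                   Chop P Q (infinite x) → Chop P Q (infinite x′)
        chop-inf {x} {x′} {k} {k′} (cuts st inc) (cuts st′ inc′) e (p , _ , a , b)
          with locate inc {p} (≤-trans (≤-reflexive st) z≤n)
        ... | i , ki≤p , p<ki with ψ-seg {x} {x′} (e i) ki≤p p<ki
        ...   | p′ , k′i≤p′ , p′<k′i , l , r =
                p′ , tt ,
                fin RP {p} {x} {p′} {x′} (comp-seg RP z≤n (m≤n⇒m≤1+n ki≤p) z≤n (m≤n⇒m≤1+n k′i≤p′)
                         (subst₂ (λ s s′ → φ RP (seg x s (k i)) ≡ φ RP (seg x′ s′ (k′ i))) st st′
                           (comp-cuts RP inc inc′ (λ i → ψ-P {seg x _ _} {seg x′ _ _} (e i)) i)) l) a ,
                inf-suffix RQ {x} {x′} {rest p k} {rest p′ k′}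
                  (rest-increasing inc p<ki) (rest-increasing inc′ p′<k′i)
                  (λ { zero → r ; (suc j) → ψ-Q {seg x _ _} {seg x′ _ _} (e (suc (j + i)))}) b
          where
            rest : ℕ → (ℕ → ℕ) → ℕ → ℕ
            rest p k zero    = p
            rest p k (suc j) = k (suc (j + i))
            rest-increasing : ∀ {p} {k : ℕ → ℕ} → (∀ i → k i < k (suc i)) → p < k (suc i) →
                       ∀ j → rest p k j < rest p k (suc j)
            rest-increasing inc lt zero    = lt
            rest-increasing inc lt (suc j) = inc (suc (j + i))

  -- Closure under images of deletions

  module _ (h : State n′ → Maybe (State n)) {P : Interval n′ → Set} (R : Rec P) where

    private
      Preimages : List (State n) → Fin (size R) → Set
      Preimages u t = ∃[ u′ ] mapMaybe h u′ ≡ u × φ R u′ ≡ t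

      ψ : List (State n) → Fin (2 ^ size R)
      ψ = code ∘ Preimages

      ψ-lift : ∀ {u v} → ψ u ≡ ψ v → ∀ u′ → mapMaybe h u′ ≡ u →
               ∃[ v′ ] mapMaybe h v′ ≡ v × φ R v′ ≡ φ R u′
      ψ-lift e u′ eq = code-⇒ e (φ R u′) (u′ , eq , refl)

      ψ-comp : ∀ {u u₁ v v₁} → ψ u ≡ ψ u₁ → ψ v ≡ ψ v₁ →
               ∀ t → Preimages (u ++ v) t → Preimages (u₁ ++ v₁) t
      ψ-comp {u} e e′ t (w , eq , refl) with mapMaybe-++⁻ h w u eq
      ... | w₁ , w₂ , refl , e₁ , e₂ with ψ-lift e w₁ e₁ | ψ-lift e′ w₂ e₂
      ...   | v₁ , f₁ , g₁ | v₂ , f₂ , g₂ =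
              v₁ ++ v₂ , trans (mapMaybe-++ h v₁ v₂) (cong₂ _++_ f₁ f₂) , comp R g₁ g₂

      seg-nonempty : ∀ (x : ℕ → State n) {i j} → i < j → 0 < length (seg x i j)
      seg-nonempty x {i} {j} i<j = subst (0 <_) (sym (length-seg x i j)) (m<n⇒0<n∸m i<j)

    rec-Im : Rec (Im h P)
    rec-Im = record
      { size = 2 ^ size R
      ; φ    = ψ
      ; comp = λ e e′ → code-cong (ψ-comp e e′) (ψ-comp (sym e) (sym e′))
      ; fin  = im-fin
      ; inf  = im-inf
      }
      where
        im-fin : ∀ {m x m′ x′} → ψ (seg x 0 (suc m)) ≡ ψ (seg x′ 0 (suc m′)) →
                 Im h P (finite m x) → Im h P (finite m′ x′)
        im-fin {m} {x} {m′} {x′} e (inj₁ (l , y , eq , p)) with ψ-lift e (seg y 0 (suc l)) eq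
        ... | [] , f , _ with () ← mapMaybe-length-> h [] f (seg-nonempty x′ {0} {suc m′} z<s)
        ... | a ∷ v′ , f , g = inj₁ (length v′ , nth a (a ∷ v′) ,
                  trans (cong (mapMaybe h) (seg-nth a (a ∷ v′))) f ,
                  fin R (trans (sym g) (cong (φ R) (sym (seg-nth a (a ∷ v′))))) p)
        -- The prefix of `y` that contains all survivors is replaced by a word `v` of the same
        -- φ-value. The rest of `y`, where everything is deleted, is kept and cut into single
        -- letters, which gives `y` and `flat` matching pieces.
        im-fin {m} {x} {m′} {x′} e (inj₂ (y , l , eq , none , p)) with ψ-lift e (seg y 0 l) eq
        ... | v , f , g = inj₂ (flat , cut 1 , trans (cong (mapMaybe h) (seg-flat 0)) f ,
                none′ , inf R (cuts refl ycut-increasing) cut-cuts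
                          (λ i → trans (same i) (cong (φ R) (sym (seg-flat i)))) p)
          where
            us : ℕ → List (State _)
            us zero    = v
            us (suc i) = [ y (l + i) ]
            us-nonempty : ∀ i → 0 < length (us i)
            us-nonempty zero    = mapMaybe-length-> h v f (seg-nonempty x′ {0} {suc m′} z<s)
            us-nonempty (suc i) = z<s
            open Flatten default us us-nonempty
            0<l : 0 < l
            0<l = n≢0⇒n>0 λ { refl → <-irrefl (cong length (trans (sym (cong (mapMaybe h) (seg-[] y 0))) eq))
                                         (seg-nonempty x {0} {suc m} z<s) }
            ycut : ℕ → ℕ
            ycut zero    = 0
            ycut (suc i) = l + i
            ycut-increasing : ∀ i → ycut i < ycut (suc i)
            ycut-increasing zero    = subst (0 <_) (sym (+-identityʳ l)) 0<l
            ycut-increasing (suc i) = +-monoʳ-< l ≤-refl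
            same : ∀ i → φ R (seg y (ycut i) (ycut (suc i))) ≡ φ R (us i)
            same zero    = trans (cong (λ j → φ R (seg y 0 j)) (+-identityʳ l)) (sym g)
            same (suc i) = cong (φ R) (trans (cong (seg y (l + i)) (+-suc l i)) (seg-[-] y (l + i)))
            cut-+ : ∀ i → cut (suc i) ≡ cut 1 + i
            cut-+ zero    = sym (+-identityʳ (cut 1))
            cut-+ (suc i) = trans (length-++ (pre (suc i)))
              (trans (cong (_+ 1) (cut-+ i)) (trans (+-assoc (cut 1) i 1) (cong (cut 1 +_) (+-comm i 1))))
            flat-+ : ∀ i → flat (cut (suc i)) ≡ y (l + i)
            flat-+ i = ∷-injectiveˡ (trans (sym (seg-∷ flat (cut-increasing (suc i)))) (seg-flat (suc i)))
            none′ : ∀ k → cut 1 ≤ k → h (flat k) ≡ nothing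
            none′ k c≤k = trans (cong h (trans (cong flat (sym (trans (cut-+ (k ∸ cut 1)) (m+[n∸m]≡n c≤k))))
                                   (flat-+ (k ∸ cut 1)))) (none _ (m≤m+n l _))

        im-inf : ∀ {x x′} {k k′ : ℕ → ℕ} → Cuts k → Cuts k′ →
                 (∀ i → ψ (seg x (k i) (k (suc i))) ≡ ψ (seg x′ (k′ i) (k′ (suc i)))) →
                 Im h P (infinite x) → Im h P (infinite x′)
        im-inf {x} {x′} {k} {k′} (cuts st inc) (cuts st′ inc′) e (y , f , p) =
          flat , prefix , inf R (cuts refl l-increasing) cut-cuts
            (λ i → trans (sym (proj₂ (proj₂ (lift i)))) (cong (φ R) (sym (seg-flat i)))) p
          where
            -- `f` may choose any prefix of `y` with the required image, but a strictly longer image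
            -- forces a strictly longer prefix, so its choices form an increasing sequence. The
            -- value at 0 is fixed separately because cuts start at 0.
            l : ℕ → ℕ
            l zero    = 0
            l (suc i) = proj₁ (f (k (suc i)))
            l-prefix : ∀ i → mapMaybe h (seg y 0 (l i)) ≡ seg x 0 (k i)
            l-prefix zero    = trans (cong (mapMaybe h) (seg-[] y 0))
                                 (sym (trans (cong (seg x 0) st) (seg-[] x 0)))
            l-prefix (suc i) = proj₂ (f (k (suc i)))
            kept-l : ∀ i → kept h y (l i) ≡ k i
            kept-l i = trans (cong length (l-prefix i)) (length-seg x 0 (k i))
            l-increasing : ∀ i → l i < l (suc i)
            l-increasing i = kept-<⁻¹ h y (subst₂ _<_ (sym (kept-l i)) (sym (kept-l (suc i))) (inc i))
            l-seg : ∀ i → mapMaybe h (seg y (l i) (l (suc i))) ≡ seg x (k i) (k (suc i))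
            l-seg i = ++-cancelˡ (seg x 0 (k i)) _ _ (begin
              seg x 0 (k i) ++ mapMaybe h (seg y (l i) (l (suc i)))
                ≡⟨ cong (_++ mapMaybe h (seg y (l i) (l (suc i)))) (sym (l-prefix i)) ⟩
              mapMaybe h (seg y 0 (l i)) ++ mapMaybe h (seg y (l i) (l (suc i)))
                ≡⟨ sym (mapMaybe-seg-++ h y z≤n (<⇒≤ (l-increasing i))) ⟩
              mapMaybe h (seg y 0 (l (suc i)))
                ≡⟨ l-prefix (suc i) ⟩
              seg x 0 (k (suc i))
                ≡⟨ sym (seg-++ x z≤n (<⇒≤ (inc i))) ⟩
              seg x 0 (k i) ++ seg x (k i) (k (suc i)) ∎)
              where open ≡-Reasoning
            lift : ∀ i → ∃[ v ] mapMaybe h v ≡ seg x′ (k′ i) (k′ (suc i)) ×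
                                φ R v ≡ φ R (seg y (l i) (l (suc i)))
            lift i = ψ-lift (e i) (seg y (l i) (l (suc i))) (l-seg i)
            us : ℕ → List (State _)
            us i = proj₁ (lift i)
            open Flatten default us (λ i → mapMaybe-length-> h (us i) (proj₁ (proj₂ (lift i)))
                                              (seg-nonempty x′ (inc′ i)))
            pre-image : ∀ i → mapMaybe h (pre i) ≡ seg x′ 0 (k′ i)
            pre-image zero    = sym (trans (cong (seg x′ 0) st′) (seg-[] x′ 0))
            pre-image (suc i) = trans (mapMaybe-++ h (pre i) (us i))
              (trans (cong₂ _++_ (pre-image i) (proj₁ (proj₂ (lift i))))
                     (seg-++ x′ z≤n (<⇒≤ (inc′ i))))
            prefix : ∀ i → ∃[ j ] mapMaybe h (seg flat 0 j) ≡ seg x′ 0 i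
            prefix i = proj₁ split , proj₁ (proj₂ (proj₂ (proj₂ split)))
              where
                split : ∃[ j ] 0 ≤ j × j ≤ cut i × mapMaybe h (seg flat 0 j) ≡ seg x′ 0 i ×
                               mapMaybe h (seg flat j (cut i)) ≡ seg x′ i (k′ i)
                -- The first i lifted pieces have an image of length `k′ i`, which is at least i.
                split = mapMaybe-seg-++⁻ h flat z≤n (seg x′ 0 i)
                  (trans (cong (mapMaybe h) (seg-flat₀ i)) (trans (pre-image i)
                    (sym (seg-++ x′ z≤n (expanding inc′ i)))))

  -- Inverse projection as the image of a deletion

  keep : ITL n → State n → Maybe (State n)
  keep w a with em {a ⊨ₛ w}
  ... | yes _ = just a
  ... | no  _ = nothing

  keep-just : ∀ (w : ITL n) {a b} → keep w a ≡ just b → a ⊨ₛ w × a ≡ b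
  keep-just w {a} eq with em {a ⊨ₛ w}
  ... | yes aw = aw , just-injective eq
  keep-just w () | no _

  keep-⊨ : ∀ (w : ITL n) {a} → a ⊨ₛ w → keep w a ≡ just a
  keep-⊨ w {a} aw with em {a ⊨ₛ w}
  ... | yes _ = refl
  ... | no ¬aw = contradiction aw ¬aw

  keep-⊭ : ∀ (w : ITL n) {a} → ¬ a ⊨ₛ w → keep w a ≡ nothing
  keep-⊭ w {a} ¬aw with em {a ⊨ₛ w}
  ... | yes aw = contradiction aw ¬aw
  ... | no  _  = refl

  Position-≤ : (σ : Interval n) {i j : ℕ} → i ≤ j → Position σ j → Position σ i
  Position-≤ (finite m x) i≤j j≤m = ≤-trans i≤j j≤m
  Position-≤ (infinite x) _   _   = tt

  module _ (w : ITL n) {σ′ σ : Interval n} (r : Restricts w σ′ σ) where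
    open Restricts r

    private
      x′ = at σ′
      x  = at σ

    dropped : ∀ {k} → Position σ′ k → (∀ i → Position σ i → pos i ≢ k) →
              keep w (x′ k) ≡ nothing
    dropped {k} k∈σ′ other = keep-⊭ w λ kw →
      case complete k k∈σ′ kw of λ { (i , i∈σ , eq) → other i i∈σ eq }

    dropped-after : ∀ {j} → Position σ j → (∀ i → j < i → ¬ Position σ i) →
                    ∀ k → Position σ′ k → suc (pos j) ≤ k → keep w (x′ k) ≡ nothing
    dropped-after {j} j∈σ last k k∈σ′ j<k = dropped k∈σ′ other
      where
        other : ∀ i → Position σ i → pos i ≢ k
        other i i∈σ refl with <-cmp i j
        ... | tri< i<j _ _ = <-asym j<k (increasing i j i<j j∈σ)
        ... | tri≈ _ refl _ = <-irrefl refl j<k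
        ... | tri> _ _ j<i = last i j<i i∈σ

    dropped-before : ∀ {j} → Position σ j → ∀ k → (∀ i → i < j → pos i < k) → k < pos j →
                     keep w (x′ k) ≡ nothing
    dropped-before {j} j∈σ k before k<j =
      dropped (Position-≤ σ′ (<⇒≤ k<j) (position j j∈σ)) other
      where
        other : ∀ i → Position σ i → pos i ≢ k
        other i i∈σ refl with <-cmp i j
        ... | tri< i<j _ _ = <-irrefl refl (before i i<j)
        ... | tri≈ _ refl _ = <-irrefl refl k<j
        ... | tri> _ _ j<i = <-asym k<j (increasing j i j<i i∈σ)

    pos-kept : ∀ {i} → Position σ i → keep w (x′ (pos i)) ≡ just (x i)
    pos-kept {i} i∈σ = trans (keep-⊨ w (sound i i∈σ)) (cong just (sym (states i i∈σ)))

    -- By `complete`, nothing survives before `pos 0` or strictly between consecutive values of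
    -- `pos`, so each step of the induction adds exactly one letter.
    kept-prefix : ∀ i → Position σ i →
                  mapMaybe (keep w) (seg x′ 0 (suc (pos i))) ≡ seg x 0 (suc i)
    kept-prefix zero i∈σ = trans (mapMaybe-seg-suc (keep w) x′ (pos-kept i∈σ))
      (trans (cong (_++ [ x 0 ]) (mapMaybe-none (keep w) x′ z≤n
                λ k _ k<p → dropped-before i∈σ k (λ _ ()) k<p))
             (sym (seg-[-] x 0)))
    kept-prefix (suc i) si∈σ = trans (mapMaybe-seg-suc (keep w) x′ (pos-kept si∈σ))
      (trans (cong (_++ [ x (suc i) ])
               (trans (mapMaybe-seg-++ (keep w) x′ z≤n i<si)
               (trans (cong₂ _++_ (kept-prefix i i∈σ) (mapMaybe-none (keep w) x′ i<si gap))
                      (++-identityʳ _))))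
             (sym (seg-∷ʳ x z≤n)))
      where
        i∈σ : Position σ i
        i∈σ = Position-≤ σ (n≤1+n i) si∈σ
        i<si : pos i < pos (suc i)
        i<si = increasing i (suc i) ≤-refl si∈σ
        gap : ∀ k → suc (pos i) ≤ k → k < pos (suc i) → keep w (x′ k) ≡ nothing
        gap k i<k k<si = dropped-before si∈σ k before k<si
          where
            before : ∀ j → j < suc i → pos j < k
            before j j<si with m≤n⇒m<n∨m≡n (s≤s⁻¹ j<si)
            ... | inj₁ j<i  = <-trans (increasing j i j<i i∈σ) i<k
            ... | inj₂ refl = i<k

  Restricts⇒Im : (w : ITL n) {P : Interval n → Set} (σ′ σ : Interval n) →
                 Restricts w σ′ σ → P σ′ → Im (keep w) P σ
  Restricts⇒Im w (finite m′ x′) (finite m x) r p =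
    inj₁ (m′ , x′ , trans (mapMaybe-seg-++ (keep w) x′ z≤n pm<)
      (trans (cong₂ _++_ (kept-prefix w r m ≤-refl)
                (mapMaybe-none (keep w) x′ pm< λ k pm<k k< →
                  dropped-after w r ≤-refl (λ i m<i i≤m → <⇒≱ m<i i≤m) k (s≤s⁻¹ k<) pm<k))
             (++-identityʳ _)) , p)
    where
      pm< : suc (Restricts.pos r m) ≤ suc m′
      pm< = s≤s (Restricts.position r m ≤-refl)
  Restricts⇒Im w (infinite x′) (finite m x) r p =
    inj₂ (x′ , suc (Restricts.pos r m) , kept-prefix w r m ≤-refl ,
      (λ k → dropped-after w r ≤-refl (λ i m<i i≤m → <⇒≱ m<i i≤m) k tt) , p)
  -- Impossible: `pos` would map infinitely many positions injectively into m′ + 1 positions.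
  Restricts⇒Im w (finite m′ x′) (infinite x) r p =
    contradiction (Restricts.position r (suc m′) tt)
      (<⇒≱ (expanding (λ i → Restricts.increasing r i (suc i) ≤-refl tt) (suc m′)))
  Restricts⇒Im w (infinite x′) (infinite x) r p = x′ , prefix , p
    where
      prefix : ∀ i → ∃[ l ] mapMaybe (keep w) (seg x′ 0 l) ≡ seg x 0 i
      prefix zero    = 0 , trans (cong (mapMaybe (keep w)) (seg-[] x′ 0)) (sym (seg-[] x 0))
      prefix (suc i) = suc (Restricts.pos r i) , kept-prefix w r i tt

  -- The shared core of the three cases of `Im`. The last survivor in a prefix whose image has
  -- `suc i` states is the i-th one, which defines `pos`; the second hypothesis says that every
  -- survivor has an index within σ, which yields `complete`.
  restricts : (w : ITL n) (σ′ σ : Interval n) →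
    (∀ i → Position σ i → ∃[ l ] (∀ k → k < l → Position σ′ k) ×
       mapMaybe (keep w) (seg (at σ′) 0 l) ≡ seg (at σ) 0 (suc i)) →
    (∀ k → Position σ′ k → at σ′ k ⊨ₛ w → Position σ (kept (keep w) (at σ′) k)) →
    Restricts w σ′ σ
  restricts w σ′ σ prefix bounded = record
    { pos        = pos
    ; position   = λ i i∈σ → proj₁ (pos-spec i∈σ)
    ; increasing = λ i j i<j j∈σ → kept-<⁻¹ (keep w) x′
        (subst₂ _<_ (sym (kept-pos (Position-≤ σ (<⇒≤ i<j) j∈σ))) (sym (kept-pos j∈σ)) i<j)
    ; sound      = λ i i∈σ → proj₁ (keep-just w (proj₂ (proj₂ (pos-spec i∈σ))))
    ; complete   = λ k k∈σ′ kw → _ , bounded k k∈σ′ kw , pos≡ k (bounded k k∈σ′ kw) kw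
    ; states     = λ i i∈σ → sym (proj₂ (keep-just w (proj₂ (proj₂ (pos-spec i∈σ)))))
    }
    where
      x′ = at σ′
      x  = at σ
      Found : ℕ → ℕ → Set
      Found i p = Position σ′ p × mapMaybe (keep w) (seg x′ 0 p) ≡ seg x 0 i ×
                  keep w (x′ p) ≡ just (x i)
      find : ∀ i → Position σ i → ∃[ p ] Found i p
      find i i∈σ = proj₁ letter ,
        proj₁ (proj₂ (prefix i i∈σ)) _ (proj₁ (proj₂ letter)) , proj₂ (proj₂ letter)
        where
          letter : ∃[ p ] p < proj₁ (prefix i i∈σ) ×
                   mapMaybe (keep w) (seg x′ 0 p) ≡ seg x 0 i × keep w (x′ p) ≡ just (x i)
          letter = mapMaybe-letter (keep w) x′ (seg x 0 i)
            (trans (proj₂ (proj₂ (prefix i i∈σ))) (seg-∷ʳ x z≤n))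
      -- `pos` has to be total, while an i-th survivor exists only for positions i of σ; elsewhere
      -- the value 0 is arbitrary.
      search : ∀ i → Dec (Position σ i) → ∃[ p ] (Position σ i → Found i p)
      search i (yes i∈σ) = proj₁ (find i i∈σ) , λ _ → proj₂ (find i i∈σ)
      search i (no  i∉σ) = 0 , λ i∈σ → contradiction i∈σ i∉σ
      pos : ℕ → ℕ
      pos i = proj₁ (search i em)
      pos-spec : ∀ {i} → Position σ i → Found i (pos i)
      pos-spec {i} = proj₂ (search i em)
      kept-pos : ∀ {i} → Position σ i → kept (keep w) x′ (pos i) ≡ i
      kept-pos {i} i∈σ = trans (cong length (proj₁ (proj₂ (pos-spec i∈σ)))) (length-seg x 0 i)
      -- `kept` increases just after each survivor, so two different survivors cannot have the same
      -- index.
      pos≡ : ∀ k → Position σ (kept (keep w) x′ k) → x′ k ⊨ₛ w → pos (kept (keep w) x′ k) ≡ k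
      pos≡ k i∈σ kw with <-cmp (pos (kept (keep w) x′ k)) k
      ... | tri≈ _ eq _ = eq
      ... | tri< p<k _ _ = contradiction (kept-mono (keep w) x′ p<k) (<⇒≱
              (subst (kept (keep w) x′ k <_) (sym (kept-suc (keep w) x′ (proj₂ (proj₂ (pos-spec i∈σ)))))
                (s≤s (≤-reflexive (sym (kept-pos i∈σ))))))
      ... | tri> _ _ k<p = contradiction (kept-mono (keep w) x′ k<p) (<⇒≱
              (subst₂ _<_ (sym (kept-pos i∈σ)) (sym (kept-suc (keep w) x′ (keep-⊨ w kw))) ≤-refl))

  Im⇒Restricts : (w : ITL n) {P : Interval n → Set} (σ : Interval n) → Im (keep w) P σ →
                 ∃[ σ′ ] Restricts w σ′ σ × P σ′
  Im⇒Restricts w (finite m x) (inj₁ (m′ , x′ , eq , p)) =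
    finite m′ x′ , restricts w (finite m′ x′) (finite m x) prefix bounded , p
    where
      prefix : ∀ i → i ≤ m → ∃[ l ] (∀ k → k < l → k ≤ m′) ×
               mapMaybe (keep w) (seg x′ 0 l) ≡ seg x 0 (suc i)
      prefix i i≤m with mapMaybe-seg-++⁻ (keep w) x′ z≤n (seg x 0 (suc i))
                          (trans eq (sym (seg-++ x z≤n (s≤s i≤m))))
      ... | l , _ , l≤ , e , _ = l , (λ k k<l → s≤s⁻¹ (≤-trans k<l l≤)) , e
      bounded : ∀ k → k ≤ m′ → x′ k ⊨ₛ w → kept (keep w) x′ k ≤ m
      bounded k k≤m′ kw = s≤s⁻¹ (subst₂ _≤_ (kept-suc (keep w) x′ (keep-⊨ w kw))
        (trans (cong length eq) (length-seg x 0 (suc m))) (kept-mono (keep w) x′ (s≤s k≤m′)))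
  Im⇒Restricts w (finite m x) (inj₂ (x′ , l , eq , none , p)) =
    infinite x′ , restricts w (infinite x′) (finite m x) prefix bounded , p
    where
      prefix : ∀ i → i ≤ m → ∃[ l ] (∀ k → k < l → ⊤) ×
               mapMaybe (keep w) (seg x′ 0 l) ≡ seg x 0 (suc i)
      prefix i i≤m with mapMaybe-seg-++⁻ (keep w) x′ z≤n (seg x 0 (suc i))
                          (trans eq (sym (seg-++ x z≤n (s≤s i≤m))))
      ... | l , _ , _ , e , _ = l , (λ _ _ → tt) , e
      bounded : ∀ k → ⊤ → x′ k ⊨ₛ w → kept (keep w) x′ k ≤ m
      bounded k _ kw with l ≤? k
      ... | yes l≤k with () ← trans (sym (keep-⊨ w kw)) (none k l≤k)
      ... | no  l≰k = s≤s⁻¹ (subst₂ _≤_ (kept-suc (keep w) x′ (keep-⊨ w kw))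
        (trans (cong length eq) (length-seg x 0 (suc m))) (kept-mono (keep w) x′ (≰⇒> l≰k)))
  Im⇒Restricts w (infinite x) (x′ , prefix , p) =
    infinite x′ , restricts w (infinite x′) (infinite x)
      (λ i _ → proj₁ (prefix (suc i)) , (λ _ _ → tt) , proj₂ (prefix (suc i))) (λ _ _ _ → tt) , p

  rec-Π⁻¹ : (w A : ITL n) → Rec (λ σ → σ ⊨ A) → Rec (λ σ → σ ⊨ w Π⁻¹ A)
  rec-Π⁻¹ w A R = rec-⇔ (λ σ → mk⇔ (Im⇒Restricts w {_⊨ A} σ)
    λ { (σ′ , r , p) → Restricts⇒Im w {_⊨ A} σ′ σ r p }) (rec-Im (keep w) R)

  -- Divisions as sets of marks

  least : {Q : ℕ → Set} → ∀ {i} → Q i → ∃[ j ] Q j × (∀ k → k < j → ¬ Q k)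
  least {Q} {i} qi = stable λ none → all-fail none (suc i) i ≤-refl qi
    where
      all-fail : ¬ (∃[ j ] Q j × (∀ k → k < j → ¬ Q k)) → ∀ b k → k < b → ¬ Q k
      all-fail none (suc b) k (s≤s k≤b) qk =
        none (k , qk , λ l l<k → all-fail none b l (≤-trans l<k k≤b))

  module _ {P : Interval n → Set} {σ : Interval n} where

    -- The division points arise by passing repeatedly to the next mark. Either this gets stuck, and
    -- the first stuck index ends a finite division, or it never does, and σ has unboundedly many
    -- positions.
    marks⇒division : ∀ {μ} → Marked P σ μ → FiniteDivision P σ ⊎ InfiniteDivision P σ
    marks⇒division {μ} M = divide em
      where
        open Marked M
        Mark : Set
        Mark = ∃[ i ] Position σ i × μ i
        Successor : Mark → Set
        Successor (i , _) = ∃[ j ] i < j × Position σ j × μ j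
        advance : (s : Mark) → Dec (Successor s) → Mark
        -- Without a further mark the sequence stays where it is; a finite division uses its values
        -- only up to the first such index.
        advance s (no _) = s
        advance s (yes (_ , q)) with least {λ j → proj₁ s < j × Position σ j × μ j} q
        ... | j , (_ , j∈σ , μj) , _ = j , j∈σ , μj
        advance-spec : ∀ s d → Successor s → proj₁ s < proj₁ (advance s d) ×
                       (∀ k → proj₁ s < k → k < proj₁ (advance s d) → ¬ μ k)
        advance-spec s (no ¬q) q = contradiction q ¬q
        advance-spec s (yes (_ , q)) _ with least {λ j → proj₁ s < j × Position σ j × μ j} q
        ... | j , (i<j , j∈σ , _) , none =
              i<j , λ k i<k k<j μk → none k k<j (i<k , Position-≤ σ (<⇒≤ k<j) j∈σ , μk)
        mark : ℕ → Mark
        mark zero    = 0 , Position-0 σ , start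
        mark (suc a) = advance (mark a) em
        k : ℕ → ℕ
        k = proj₁ ∘ mark
        increases : ∀ a → Successor (mark a) → k a < k (suc a)
        increases a s = proj₁ (advance-spec (mark a) em s)
        piece : ∀ a → Successor (mark a) → P (sub σ (k a) (k (suc a)))
        piece a s = consecutive (k a) (k (suc a)) (increases a s) (proj₁ (proj₂ (mark (suc a))))
          (proj₂ (proj₂ (mark a))) (proj₂ (proj₂ (mark (suc a))))
          (proj₂ (advance-spec (mark a) em s))
        unbounded : ∀ σ′ → (∀ a → Position σ′ (k a)) → (∀ a → k a < k (suc a)) → Infinite σ′
        unbounded (infinite _) _  _   = tt
        unbounded (finite m _) k∈ inc = contradiction (expanding inc (suc m)) (<⇒≱ (s≤s (k∈ (suc m))))
        divide : Dec (∃[ a ] ¬ Successor (mark a)) → FiniteDivision P σ ⊎ InfiniteDivision P σ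
        divide (yes (a , stuck)) with least {λ a → ¬ Successor (mark a)} {a} stuck
        ... | m , stuck-m , none = inj₁ record
          { m          = m
          ; k          = k
          ; start      = refl
          ; increasing = λ a a<m → increases a (stable {Successor (mark a)} (none a a<m))
          ; pieces     = λ a a<m → piece a (stable {Successor (mark a)} (none a a<m))
          ; last-two   = proj₁ final
          ; last-piece = proj₂ final
          }
          where
            final : Position σ (suc (k m)) × P (suffix σ (k m))
            final = last (k m) (proj₁ (proj₂ (mark m))) (proj₂ (proj₂ (mark m)))
              λ j k<j j∈σ μj → stuck-m (j , k<j , j∈σ , μj)
        divide (no never) = inj₂ record
          { σ-infinite = unbounded σ (λ a → proj₁ (proj₂ (mark a))) (λ a → increases a (go a))
          ; k          = k
          ; start      = refl
          ; increasing = λ a → increases a (go a)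
          ; pieces     = λ a → piece a (go a)
          }
          where
            go : ∀ a → Successor (mark a)
            go a = stable λ stuck → never (a , stuck)

    decide : {μ : ℕ → Set} → Marked P σ μ → Marks P σ
    decide {μ} M = (λ i → does (em {μ i})) , record
      { start       = yes⁺ start
      ; consecutive = λ i j i<j j∈ μi μj none → consecutive i j i<j j∈ (yes⁻ μi) (yes⁻ μj)
          (λ k i<k k<j μk → none k i<k k<j (yes⁺ μk))
      ; last        = λ i i∈ μi none → last i i∈ (yes⁻ μi) (λ k i<k k∈ μk → none k i<k k∈ (yes⁺ μk))
      }
      where
        open Marked M
        yes⁺ : {A : Set} → A → does (em {A}) ≡ true
        yes⁺ {A} a = dec-true (em {A}) a
        yes⁻ : {A : Set} → does (em {A}) ≡ true → A
        yes⁻ {A} eq with em {A}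
        ... | yes a = a
        yes⁻ () | no _

    -- Neighbouring marks come from neighbouring indices, because otherwise `k (suc a)` would lie
    -- strictly between them.
    division⇒marks : FiniteDivision P σ → Marks P σ
    division⇒marks D = decide {λ i → ∃[ a ] a ≤ m × k a ≡ i} record
      { start       = 0 , z≤n , start
      ; consecutive = λ { _ _ lt _ (a , a≤m , refl) (b , b≤m , refl) none → between lt a≤m b≤m none }
      ; last        = λ { _ _ (a , a≤m , refl) none → final a≤m none }
      }
      where
        open FiniteDivision D
        k-mono : ∀ {i j} → i < j → j ≤ m → k i < k j
        k-mono = strictly-mono-≤ increasing
        between : ∀ {a b} → k a < k b → a ≤ m → b ≤ m →
                  (∀ l → k a < l → l < k b → ¬ (∃[ c ] c ≤ m × k c ≡ l)) → P (sub σ (k a) (k b))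
        between {a} {b} lt a≤m b≤m none with <-cmp a b
        ... | tri≈ _ refl _ = contradiction lt (<-irrefl refl)
        ... | tri> _ _ b<a = contradiction lt (<-asym (k-mono b<a a≤m))
        ... | tri< a<b _ _ with m≤n⇒m<n∨m≡n a<b
        ...   | inj₂ refl = pieces a b≤m
        ...   | inj₁ sa<b = contradiction (suc a , ≤-trans a<b b≤m , refl)
                (none (k (suc a)) (increasing a (≤-trans a<b b≤m)) (k-mono sa<b b≤m))
        final : ∀ {a} → a ≤ m → (∀ l → k a < l → Position σ l → ¬ (∃[ c ] c ≤ m × k c ≡ l)) →
                Position σ (suc (k a)) × P (suffix σ (k a))
        final {a} a≤m none with m≤n⇒m<n∨m≡n a≤m
        ... | inj₂ refl = last-two , last-piece
        ... | inj₁ a<m  = contradiction (m , ≤-refl , refl)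
              (none (k m) (k-mono a<m ≤-refl) (Position-≤ σ (n≤1+n (k m)) last-two))

    division∞⇒marks : InfiniteDivision P σ → Marks P σ
    division∞⇒marks D = decide {λ i → ∃[ a ] k a ≡ i} record
      { start       = 0 , start
      ; consecutive = λ { _ _ lt _ (a , refl) (b , refl) none → between lt none }
      ; last        = λ { _ _ (a , refl) none →
          contradiction (suc a , refl) (none (k (suc a)) (increasing a) (everywhere σ σ-infinite)) }
      }
      where
        open InfiniteDivision D
        everywhere : ∀ σ′ → Infinite σ′ → ∀ {i} → Position σ′ i
        everywhere (infinite _) _ = tt
        between : ∀ {a b} → k a < k b → (∀ l → k a < l → l < k b → ¬ (∃[ c ] k c ≡ l)) →
                  P (sub σ (k a) (k b))
        between {a} {b} lt none with m≤n⇒m<n∨m≡n (strictly-mono⁻¹ increasing lt)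
        ... | inj₂ refl = pieces a
        ... | inj₁ sa<b = contradiction (suc a , refl)
              (none (k (suc a)) (increasing a) (strictly-mono increasing sa<b))

  -- Recognisability of correct markings

  rec-∁ : {P : Interval n → Set} → Rec P → Rec (∁ P)
  rec-∁ R = rec-⊃ R (rec-const ⊥)

  rec-∩ : {P Q : Interval n → Set} → Rec P → Rec Q → Rec (P ∩ Q)
  rec-∩ RP RQ = rec-⇔
    (λ _ → mk⇔ (λ f → stable λ g → f λ p q → g (p , q)) (λ { (p , q) f → f p q }))
    (rec-∁ (rec-⊃ RP (rec-∁ RQ)))

  rec-Next : {P : Interval n → Set} → Rec P → Rec (Next P)
  rec-Next {P = P} R = rec-⇔
    (λ σ → mk⇔ (λ { (_ , 1∈σ , refl , p) → 1∈σ , p }) (λ { (1∈σ , p) → 1 , 1∈σ , refl , p }))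
    (rec-Chop rec-Two R)

  rec-Ever : {P : Interval n → Set} → Rec P → Rec (Ever P)
  rec-Ever R = rec-Chop (rec-const ⊤) R

  module _ {P : Interval (suc n) → Set} (R : Rec P) where

    private
      Q Span Tail Bad₁ Bad₂ : Interval (suc n) → Set
      Q τ = head (at τ 0) ≡ true
      -- Marked at its first and last states only.
      Span = Q ∩ Next (Ever (Q ∩ ∁ Next All) ∩ ∁ Ever (Q ∩ Next All))
      -- Marked at its first state only.
      Tail = Q ∩ ∁ Next (Ever Q)
      -- The violations of `consecutive` and of `last` in `Marked`. `Ever` moves to the start of the
      -- offending part, and in `Bad₁` the chop with `All` cuts it off at its end.
      Bad₁ = Ever (Chop (Span ∩ ∁ P) All)
      Bad₂ = Ever (Tail ∩ ∁ (Next All ∩ P))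

      μ : Interval (suc n) → ℕ → Set
      μ τ i = head (at τ i) ≡ true

    WellMarked : Interval (suc n) → Set
    WellMarked = Q ∩ ∁ Bad₁ ∩ ∁ Bad₂

    rec-WellMarked : Rec WellMarked
    rec-WellMarked = rec-∩ rQ (rec-∩ (rec-∁ rBad₁) (rec-∁ rBad₂))
      where
        rQ : Rec Q
        rQ = rec-head (λ a → head a ≡ true)
        rAll : Rec All
        rAll = rec-const ⊤
        rBad₁ : Rec Bad₁
        rBad₁ = rec-Ever (rec-Chop (rec-∩ (rec-∩ rQ (rec-Next (rec-∩
          (rec-Ever (rec-∩ rQ (rec-∁ (rec-Next rAll))))
          (rec-∁ (rec-Ever (rec-∩ rQ (rec-Next rAll))))))) (rec-∁ R)) rAll)
        rBad₂ : Rec Bad₂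
        rBad₂ = rec-Ever (rec-∩ (rec-∩ rQ (rec-∁ (rec-Next (rec-Ever rQ))))
          (rec-∁ (rec-∩ (rec-Next rAll) R)))

    private
      span : ∀ {l y} → 0 < l → head (y 0) ≡ true → head (y l) ≡ true →
             (∀ k → 0 < k → k < l → ¬ head (y k) ≡ true) → Span (finite l y)
      span {suc l} {y} _ q0 ql none = q0 , s≤s z≤n ,
        (l , ≤-refl , tt , subst (λ j → head (y (suc j)) ≡ true) (sym (+-identityʳ l)) ql ,
           λ { (1≤ , _) → <-irrefl refl (subst (1 ≤_) (n∸n≡0 l) 1≤) }) ,
        λ { (k , k≤l , _ , qk , 1≤ , _) → none (suc k) z<s
              (s<s (m∸n≢0⇒n<m {l} {k} λ eq → <-irrefl refl (subst (1 ≤_) eq 1≤)))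
              (subst (λ j → head (y (suc j)) ≡ true) (+-identityʳ k) qk) }

      span⁻ : ∀ {l y} → Span (finite l y) → 0 < l × head (y 0) ≡ true × head (y l) ≡ true ×
             (∀ k → 0 < k → k < l → ¬ head (y k) ≡ true)
      span⁻ {suc l} {y} (q0 , s≤s _ , (k , k≤l , _ , qk , ¬1≤) , ¬ever) =
        z<s , q0 , subst (λ j → head (y (suc j)) ≡ true) (trans (+-identityʳ k) k≡l) qk , none
        where
          k≡l : k ≡ l
          k≡l with m≤n⇒m<n∨m≡n k≤l
          ... | inj₂ eq  = eq
          ... | inj₁ k<l = contradiction (m<n⇒0<n∸m k<l , tt) ¬1≤
          none : ∀ k → 0 < k → k < suc l → ¬ head (y k) ≡ true
          none (suc k) _ (s<s k<l) q = ¬ever (k , <⇒≤ k<l , tt ,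
            subst (λ j → head (y (suc j)) ≡ true) (sym (+-identityʳ k)) q , m<n⇒0<n∸m k<l , tt)

      index : ∀ i d → i + (1 + (d + 0)) ≡ suc (i + d)
      index i d = trans (+-suc i (d + 0)) (cong (λ e → suc (i + e)) (+-identityʳ d))

      Q⇒μ : ∀ τ i d → Q (suffix (suffix (suffix τ i) 1) d) → μ τ (suc (i + d))
      Q⇒μ (finite _ x) i d = subst (λ j → head (x j) ≡ true) (index i d)
      Q⇒μ (infinite x) i d = subst (λ j → head (x j) ≡ true) (index i d)

      μ⇒Q : ∀ τ i d → μ τ (suc (i + d)) → Q (suffix (suffix (suffix τ i) 1) d)
      μ⇒Q (finite _ x) i d = subst (λ j → head (x j) ≡ true) (sym (index i d))
      μ⇒Q (infinite x) i d = subst (λ j → head (x j) ≡ true) (sym (index i d))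

      unmarked-tail : ∀ τ i → Position τ i → ¬ Next (Ever Q) (suffix τ i) →
                      ∀ k → i < k → Position τ k → ¬ μ τ k
      unmarked-tail τ i i∈τ none k i<k k∈τ q =
        none (1∈ , d , Position-suffix (suffix τ i) {1} {d}
                (Position-suffix τ (subst (Position τ) (sym k≡) k∈τ)) ,
              tt , μ⇒Q τ i d (subst (μ τ) (sym (m+[n∸m]≡n i<k)) q))
        where
          d : ℕ
          d = k ∸ suc i
          k≡ : i + suc d ≡ k
          k≡ = trans (+-suc i d) (m+[n∸m]≡n i<k)
          1∈ : Position (suffix τ i) 1
          1∈ = Position-suffix τ (subst (Position τ) (+-comm 1 i) (Position-≤ τ i<k k∈τ))

      unmarked-tail⁻ : ∀ τ i → Position τ i → (∀ k → i < k → Position τ k → ¬ μ τ k) →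
                       ¬ Next (Ever Q) (suffix τ i)
      unmarked-tail⁻ τ i i∈τ none (1∈ , d , d∈ , _ , q) =
        none (i + suc d) (m<m+n i z<s)
          (Position-suffix⁻ τ i∈τ (Position-suffix⁻ (suffix τ i) {1} {d} 1∈ d∈))
          (subst (μ τ) (sym (+-suc i d)) (Q⇒μ τ i d q))

    wellMarked⇒Marked : ∀ τ → WellMarked τ → Marked P τ (μ τ)
    wellMarked⇒Marked τ (q0 , ¬bad₁ , ¬bad₂) = record
      { start       = q0
      ; consecutive = λ i j i<j j∈τ μi μj none → stable λ ¬p →
          ¬bad₁ (i , Position-≤ τ (<⇒≤ i<j) j∈τ , tt ,
            j ∸ i , Position-suffix τ (subst (Position τ) (sym (m+[n∸m]≡n (<⇒≤ i<j))) j∈τ) ,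
            subst (Span ∩ ∁ P) (sym (sub-suffix τ i (j ∸ i)))
              (span {j ∸ i} {at τ ∘ (i +_)} (m<n⇒0<n∸m i<j)
                 (subst (μ τ) (sym (+-identityʳ i)) μi)
                 (subst (μ τ) (sym (m+[n∸m]≡n (<⇒≤ i<j))) μj)
                 (λ k 0<k k< → none (i + k) (m<m+n i 0<k)
                    (subst (i + k <_) (m+[n∸m]≡n (<⇒≤ i<j)) (+-monoʳ-< i k<))) , ¬p) , tt)
      ; last        = λ i i∈τ μi none → stable λ ¬p →
          ¬bad₂ (i , i∈τ , tt ,
            (trans (cong head (trans (at-suffix τ i 0) (cong (at τ) (+-identityʳ i)))) μi ,
             unmarked-tail⁻ τ i i∈τ none) ,
            λ { ((1∈ , _) , p) → ¬p (subst (Position τ) (+-comm i 1) (Position-suffix⁻ τ i∈τ 1∈) , p) })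
      }

    Marked⇒wellMarked : ∀ τ → Marked P τ (μ τ) → WellMarked τ
    Marked⇒wellMarked τ M = start , no-bad₁ , no-bad₂
      where
        open Marked M
        no-bad₁ : ¬ Bad₁ τ
        no-bad₁ (i , i∈τ , _ , l , l∈ , (s , ¬p) , _)
          with span⁻ {l} {at τ ∘ (i +_)} (subst Span (sub-suffix τ i l) s)
        ... | 0<l , qi , ql , none = ¬p (subst P (sym (sub-suffix τ i l))
              (fin-cong R (m+n∸m≡n i l) (λ _ _ → refl)
                (consecutive i (i + l) (m<m+n i 0<l) (Position-suffix⁻ τ i∈τ l∈)
                  (subst (μ τ) (+-identityʳ i) qi) ql none′)))
          where
            none′ : ∀ k → i < k → k < i + l → ¬ μ τ k
            none′ k i<k k< μk = none (k ∸ i) (m<n⇒0<n∸m i<k)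
              (subst (k ∸ i <_) (m+n∸m≡n i l) (∸-monoˡ-< k< (<⇒≤ i<k)))
              (subst (μ τ) (sym (m+[n∸m]≡n (<⇒≤ i<k))) μk)
        no-bad₂ : ¬ Bad₂ τ
        no-bad₂ (i , i∈τ , _ , (q , ¬next) , ¬p)
          with last i i∈τ (trans (cong head (sym (trans (at-suffix τ i 0) (cong (at τ) (+-identityʳ i))))) q)
                 (unmarked-tail τ i i∈τ ¬next)
        ... | si∈τ , p = ¬p ((Position-suffix τ (subst (Position τ) (+-comm 1 i) si∈τ) , tt) , p)

  -- Forgetting the marks

  module _ {P : Interval n → Set} (R : Rec P) where

    private
      forget : State (suc n) → Maybe (State n)
      forget = just ∘ tail

      P↑ : Interval (suc n) → Set
      P↑ = P ∘ mapI tail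

      R↑ : Rec P↑
      R↑ = rec-mapI tail R

      mapMaybe-forget : ∀ u → mapMaybe forget u ≡ map tail u
      mapMaybe-forget u = trans (sym (mapMaybe-map just tail u)) (mapMaybe-just (map tail u))

      forget-seg : ∀ x l → mapMaybe forget (seg x 0 l) ≡ seg (tail ∘ x) 0 l
      forget-seg x l = trans (mapMaybe-forget (seg x 0 l)) (seg-map tail x 0 l)

      seg-≡ : ∀ {x y : ℕ → State n} {l m} → seg x 0 l ≡ seg y 0 m → l ≡ m × (∀ i → i < m → x i ≡ y i)
      seg-≡ {x} {y} {l} {m} eq with trans (sym (length-seg x 0 l)) (trans (cong length eq) (length-seg y 0 m))
      ... | refl = refl , applyUpTo-injective l (trans (sym (seg-def x 0 l)) (trans eq (seg-def y 0 l)))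

      module _ {μ : ℕ → Set} where
        -- The witness provided by `Im` agrees with the given interval only state by state, so P is
        -- transported by `fin-cong` wherever `Marked` uses it.
        unlift-fin : ∀ {m x y} → (∀ i → i ≤ m → tail (x i) ≡ y i) →
                     Marked P↑ (finite m x) μ → Marked P (finite m y) μ
        unlift-fin {m} eq M = record
          { start       = start
          ; consecutive = λ i j i<j j≤m μi μj none → fin-cong R refl
              (λ k k≤ → eq (i + k) (≤-trans (+-monoʳ-≤ i k≤) (≤-trans (≤-reflexive (m+[n∸m]≡n (<⇒≤ i<j))) j≤m)))
              (consecutive i j i<j j≤m μi μj none)
          ; last        = λ i i≤m μi none → proj₁ (last i i≤m μi none) , fin-cong R refl
              (λ k k≤ → eq (i + k) (≤-trans (+-monoʳ-≤ i k≤) (≤-reflexive (m+[n∸m]≡n i≤m))))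
              (proj₂ (last i i≤m μi none))
          }
          where open Marked M

        unlift-inf : ∀ {x y} → (∀ i → tail (x i) ≡ y i) →
                     Marked P↑ (infinite x) μ → Marked P (infinite y) μ
        unlift-inf eq M = record
          { start       = start
          ; consecutive = λ i j i<j j∈ μi μj none → fin-cong R refl
              (λ k _ → eq (i + k)) (consecutive i j i<j j∈ μi μj none)
          ; last        = λ i i∈ μi none → tt , inf-cong R
              (λ k → eq (i + k)) (proj₂ (last i i∈ μi none))
          }
          where open Marked M

      unmark : ∀ σ → Im forget (WellMarked R↑) σ → Marks P σ
      unmark (finite m x) (inj₁ (m′ , x′ , eq , M))
        with seg-≡ (trans (sym (forget-seg x′ (suc m′))) eq)
      ... | refl , eq′ = _ , unlift-fin (λ i i≤m → eq′ i (s≤s i≤m)) (wellMarked⇒Marked R↑ (finite m′ x′) M)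
      -- `forget` deletes no state, so an infinite sequence cannot have a finite image.
      unmark (finite m x) (inj₂ (x′ , l , _ , none , _)) with () ← none l ≤-refl
      unmark (infinite x) (x′ , prefix , M) =
        _ , unlift-inf (λ i → proj₂ (seg-≡ (trans (sym (forget-seg x′ _)) (proj₂ (prefix (suc i))))) i ≤-refl)
              (wellMarked⇒Marked R↑ (infinite x′) M)

      mark : ∀ σ → Marks P σ → Im forget (WellMarked R↑) σ
      mark (finite m x) (b , M) = inj₁ (m , y , forget-seg y (suc m) , Marked⇒wellMarked R↑ (finite m y) M′)
        where
          y : ℕ → State (suc n)
          y i = b i ∷ᵥ x i
          M′ : Marked P↑ (finite m y) (λ i → b i ≡ true)
          M′ = record { start = start ; consecutive = consecutive ; last = last }
            where open Marked M
      mark (infinite x) (b , M) = y , (λ i → i , forget-seg y i) , Marked⇒wellMarked R↑ (infinite y) M′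
        where
          y : ℕ → State (suc n)
          y i = b i ∷ᵥ x i
          M′ : Marked P↑ (infinite y) (λ i → b i ≡ true)
          M′ = record { start = start ; consecutive = consecutive ; last = last }
            where open Marked M

    rec-Marks : Rec (Marks P)
    rec-Marks = rec-⇔ (λ σ → mk⇔ (unmark σ) (mark σ))
      (rec-Im forget (rec-WellMarked R↑))

  -- Recognisability of all formulas

  rec-⊨ : (A : ITL n) → Rec (λ σ → σ ⊨ A)
  rec-⊨ ⊥′      = rec-const ⊥
  rec-⊨ (var p) = rec-head (λ a → p Subset.∈ a)
  rec-⊨ (A ⊃ B) = rec-⊃ (rec-⊨ A) (rec-⊨ B)
  rec-⊨ (○ A)   = rec-Next (rec-⊨ A)
  rec-⊨ (A ⨾ B) = rec-Chop (rec-⊨ A) (rec-⊨ B)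
  -- On a single state no marking satisfies `last`, which demands two states in the last piece; the
  -- premise `Next All` exempts this case, as `_✶` does.
  rec-⊨ (A ✶)   = rec-⇔ star (rec-⊃ (rec-Next (rec-const ⊤)) (rec-Marks (rec-⊨ A)))
    where
      star : ∀ σ → (Next All σ → Marks (_⊨ A) σ) ⇔ σ ⊨ A ✶
      star σ = mk⇔ (λ f → to f em) from
        where
          to : (Next All σ → Marks (_⊨ A) σ) → Dec (Position σ 1) → σ ⊨ A ✶
          to f (no ¬1) = inj₁ ¬1
          to f (yes 1∈σ) = inj₂ (marks⇒division (proj₂ (f (1∈σ , tt))))
          from : σ ⊨ A ✶ → Next All σ → Marks (_⊨ A) σ
          from (inj₁ ¬1) (1∈σ , _) = contradiction 1∈σ ¬1
          from (inj₂ (inj₁ D)) _ = division⇒marks D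
          from (inj₂ (inj₂ D)) _ = division∞⇒marks D

  -- Ramsey's theorem

  Unbounded : (ℕ → Set) → Set
  Unbounded S = ∀ b → ∃[ s ] b ≤ s × S s

  bound : ∀ {N} (f : Fin N → ℕ) → ∃[ b ] (∀ i → f i ≤ b)
  bound {zero}  f = 0 , λ ()
  bound {suc N} f with bound (f ∘ suc)
  ... | b , le = f zero ⊔ b , λ { zero → m≤m⊔n _ b ; (suc i) → ≤-trans (le i) (m≤n⊔m (f zero) b) }

  -- If every colour class were bounded, an element of S above the maximum of these finitely many
  -- bounds could have no colour.
  pigeonhole : ∀ {N} {S : ℕ → Set} → Unbounded S → (f : ℕ → Fin N) →
               ∃[ c ] Unbounded (λ s → S s × f s ≡ c)
  pigeonhole {N} {S} unb f = stable λ none →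
    let escape : ∀ c → ∃[ b ] ¬ (∃[ s ] b ≤ s × S s × f s ≡ c)
        escape c = stable λ ne → none (c , λ b → stable λ nb → ne (b , nb))
        b , le = bound (proj₁ ∘ escape)
        s , b≤s , ss = unb b
    in proj₂ (escape (f s)) (s , ≤-trans (le (f s)) b≤s , ss , refl)

  -- Ramsey's theorem, restricted to consecutive elements of the homogeneous set.
  ramsey : ∀ {N} (c : ℕ → ℕ → Fin N) → ∃[ e ] ∃[ k ]
           0 < k 0 × (∀ i → k i < k (suc i)) × (∀ i → c (k i) (k (suc i)) ≡ e)
  ramsey {N} c = proj₁ homogeneous , k , a-positive (t 0) ,
      (λ i → proj₁ (a-related (t-increasing i))) ,
      (λ i → trans (proj₂ (a-related (t-increasing i))) (t-colour i))
    where
      Stage : Set₁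
      Stage = Σ (ℕ → Set) Unbounded
      least-of : Stage → ℕ
      least-of (_ , unb) = proj₁ (unb 0)
      -- Only elements above the picked one that form one fixed colour with it are retained, so the
      -- colour of any later pair depends on its smaller element alone. A second pigeonhole,
      -- `homogeneous`, then makes it constant.
      refined : (s : Stage) → ∃[ d ] Unbounded (λ b → (proj₁ s b × least-of s < b) × c (least-of s) b ≡ d)
      refined s@(S , unb) = pigeonhole above (c (least-of s))
        where
          above : Unbounded (λ b → S b × least-of s < b)
          above b with unb (b ⊔ suc (least-of s))
          ... | r , le , Sr = r , ≤-trans (m≤m⊔n b _) le , Sr , ≤-trans (m≤n⊔m b _) le
      stage : ℕ → Stage
      -- Starting from the positive numbers makes the word before the first cut nonempty.
      stage zero    = (0 <_) , λ b → suc b , n≤1+n b , z<s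
      stage (suc i) = _ , proj₂ (refined (stage i))
      a : ℕ → ℕ
      a i = least-of (stage i)
      colour : ℕ → Fin N
      colour i = proj₁ (refined (stage i))
      a-member : ∀ i → proj₁ (stage i) (a i)
      a-member i = proj₂ (proj₂ (proj₂ (stage i) 0))
      stage-positive : ∀ i {s} → proj₁ (stage i) s → 0 < s
      stage-positive zero    p = p
      stage-positive (suc i) p = stage-positive i (proj₁ (proj₁ p))
      a-positive : ∀ i → 0 < a i
      a-positive i = stage-positive i (a-member i)
      related : ∀ {i j s} → i < j → proj₁ (stage j) s → a i < s × c (a i) s ≡ colour i
      related {i} {suc j} (s≤s i≤j) ((p , lt) , eq) with m≤n⇒m<n∨m≡n i≤j
      ... | inj₁ i<j  = related i<j p
      ... | inj₂ refl = lt , eq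
      a-related : ∀ {i j} → i < j → a i < a j × c (a i) (a j) ≡ colour i
      a-related {j = j} i<j = related i<j (a-member j)
      homogeneous : ∃[ e ] Unbounded (λ i → ⊤ × colour i ≡ e)
      homogeneous = pigeonhole (λ b → b , ≤-refl , tt) colour
      pick : ∀ b → ∃[ s ] b ≤ s × ⊤ × colour s ≡ proj₁ homogeneous
      pick = proj₂ homogeneous
      t : ℕ → ℕ
      t zero    = proj₁ (pick 0)
      t (suc i) = proj₁ (pick (suc (t i)))
      t-increasing : ∀ i → t i < t (suc i)
      t-increasing i = proj₁ (proj₂ (pick (suc (t i))))
      t-colour : ∀ i → colour (t i) ≡ proj₁ homogeneous
      t-colour zero    = proj₂ (proj₂ (proj₂ (pick 0)))
      t-colour (suc i) = proj₂ (proj₂ (proj₂ (pick (suc (t i)))))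
      k : ℕ → ℕ
      k = a ∘ t

  greatest : {Q : ℕ → Set} → ∀ {i} b → Q i → (∀ k → Q k → k < b) →
             ∃[ j ] Q j × (∀ k → j < k → ¬ Q k)
  greatest zero qi below with () ← below _ qi
  greatest {Q} (suc b) qi below with em {Q b}
  ... | yes qb = b , qb , λ k b<k qk → <⇒≱ b<k (s≤s⁻¹ (below k qk))
  ... | no ¬qb = greatest b qi λ k qk → ≤∧≢⇒< (s≤s⁻¹ (below k qk)) λ { refl → ¬qb qk }

  -- Derived connectives and conditions on the first state

  module _ {σ : Interval n} where

    ∧′⁺ : ∀ {A B} → σ ⊨ A → σ ⊨ B → σ ⊨ A ∧′ B
    ∧′⁺ a b f = f a b

    ∧′⁻ : ∀ A B → σ ⊨ A ∧′ B → σ ⊨ A × σ ⊨ B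
    ∧′⁻ A B f = stable λ g → f λ a b → g (a , b)

    ∨′⁺ˡ : ∀ A B → σ ⊨ A → σ ⊨ A ∨′ B
    ∨′⁺ˡ A B a ¬a = contradiction a ¬a

    ∨′⁺ʳ : ∀ A B → σ ⊨ B → σ ⊨ A ∨′ B
    ∨′⁺ʳ A B b _ = b

    ∨′⁻ : ∀ A B → σ ⊨ A ∨′ B → σ ⊨ A ⊎ σ ⊨ B
    ∨′⁻ A B f with em {σ ⊨ A}
    ... | yes a = inj₁ a
    ... | no ¬a = inj₂ (f ¬a)

    ⋁⁺ : ∀ {N} (f : Fin N → ITL n) i → σ ⊨ f i → σ ⊨ ⋁ f
    ⋁⁺ f zero    p = ∨′⁺ˡ (f zero) (⋁ (f ∘ suc)) p
    ⋁⁺ f (suc i) p = ∨′⁺ʳ (f zero) (⋁ (f ∘ suc)) (⋁⁺ (f ∘ suc) i p)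

    ⋁⁻ : ∀ {N} (f : Fin N → ITL n) → σ ⊨ ⋁ f → ∃[ i ] σ ⊨ f i
    ⋁⁻ {suc N} f p with ∨′⁻ (f zero) (⋁ (f ∘ suc)) p
    ... | inj₁ q = zero , q
    ... | inj₂ q with ⋁⁻ (f ∘ suc) q
    ...   | i , r = suc i , r

  -- The condition does not depend on the interval, so excluded middle chooses the formula once and
  -- for all.
  when : Set → ITL n → ITL n
  when C A with em {C}
  ... | yes _ = A
  ... | no  _ = ⊥′

  when⁺ : ∀ {C A} {σ : Interval n} → C → σ ⊨ A → σ ⊨ when C A
  when⁺ {C = C} c p with em {C}
  ... | yes _ = p
  ... | no ¬c = contradiction c ¬c

  when⁻ : ∀ {C} A {σ : Interval n} → σ ⊨ when C A → C × σ ⊨ A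
  when⁻ {C = C} A p with em {C}
  ... | yes c = c , p

  -- Shannon expansion: over a finite vocabulary every predicate on states is given by a decision
  -- tree on the variables. `ρ` places the variables still to be tested in the whole vocabulary.
  select : ∀ {k} → (Fin k → Fin n) → (Vec Bool k → Set) → ITL n
  select {k = zero}  ρ Q = when (Q []ᵥ) ⊤′
  select {k = suc k} ρ Q =
    (var (ρ zero) ∧′ select (ρ ∘ suc) (Q ∘ (true ∷ᵥ_))) ∨′
    (¬′ var (ρ zero) ∧′ select (ρ ∘ suc) (Q ∘ (false ∷ᵥ_)))

  select⁺ : ∀ {k} (ρ : Fin k → Fin n) (Q : Vec Bool k → Set) {σ} →
            Q (tabulate (lookup (at σ 0) ∘ ρ)) → σ ⊨ select ρ Q
  select⁺ {k = zero}  ρ Q {σ} q = when⁺ {σ = σ} q id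
  select⁺ {k = suc k} ρ Q {σ} q with lookup (at σ 0) (ρ zero) in eq
  ... | true  = ∨′⁺ˡ {σ = σ} (var (ρ zero) ∧′ _) _
          (∧′⁺ {σ = σ} {var (ρ zero)} {select (ρ ∘ suc) (Q ∘ (true ∷ᵥ_))}
            (lookup⇒[]= (ρ zero) (at σ 0) eq) (select⁺ (ρ ∘ suc) _ {σ} q))
  ... | false = ∨′⁺ʳ {σ = σ} (var (ρ zero) ∧′ _) (¬′ var (ρ zero) ∧′ _)
          (∧′⁺ {σ = σ} {¬′ var (ρ zero)} {select (ρ ∘ suc) (Q ∘ (false ∷ᵥ_))}
            (λ p → case trans (sym eq) ([]=⇒lookup p) of λ ()) (select⁺ (ρ ∘ suc) _ {σ} q))

  select⁻ : ∀ {k} (ρ : Fin k → Fin n) (Q : Vec Bool k → Set) {σ} →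
            σ ⊨ select ρ Q → Q (tabulate (lookup (at σ 0) ∘ ρ))
  select⁻ {k = zero}  ρ Q {σ} p = proj₁ (when⁻ ⊤′ {σ} p)
  select⁻ {k = suc k} ρ Q {σ} p
    with ∨′⁻ {σ = σ} (var (ρ zero) ∧′ _) (¬′ var (ρ zero) ∧′ _) p
  ... | inj₁ q with ∧′⁻ {σ = σ} (var (ρ zero)) (select (ρ ∘ suc) (Q ∘ (true ∷ᵥ_))) q
  ...   | v , r = subst (λ b → Q (b ∷ᵥ tabulate (lookup (at σ 0) ∘ ρ ∘ suc))) (sym ([]=⇒lookup v))
                     (select⁻ (ρ ∘ suc) _ {σ} r)
  select⁻ {k = suc k} ρ Q {σ} p | inj₂ q
    with ∧′⁻ {σ = σ} (¬′ var (ρ zero)) (select (ρ ∘ suc) (Q ∘ (false ∷ᵥ_))) q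
  ...   | v , r = subst (λ b → Q (b ∷ᵥ tabulate (lookup (at σ 0) ∘ ρ ∘ suc))) (sym (absent _ refl))
                     (select⁻ (ρ ∘ suc) _ {σ} r)
    where
      absent : ∀ b → lookup (at σ 0) (ρ zero) ≡ b → lookup (at σ 0) (ρ zero) ≡ false
      absent true  eq = contradiction (lookup⇒[]= (ρ zero) (at σ 0) eq) v
      absent false eq = eq

  first : (State n → Set) → ITL n
  first Q = select id Q

  first⁺ : ∀ (Q : State n → Set) {σ} → Q (at σ 0) → σ ⊨ first Q
  first⁺ Q {σ} q = select⁺ id Q {σ} (subst Q (sym (tabulate∘lookup (at σ 0))) q)

  first⁻ : ∀ (Q : State n → Set) {σ} → σ ⊨ first Q → Q (at σ 0)
  first⁻ Q {σ} p = subst Q (tabulate∘lookup (at σ 0)) (select⁻ id Q {σ} p)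

  -- Kleene's construction

  module _ {P : Interval n → Set} (R : Rec P) where

    private
      T : Set
      T = Fin (size R)

    -- The factor y a, …, y (b - 1) leads from i to j through types in S.
    record Path (S : List T) (i j : T) (y : ℕ → State n) (a b : ℕ) : Set where
      field
        nonempty : a < b
        u        : List (State n)
        from     : φ R u ≡ i
        to       : φ R (u ++ seg y a b) ≡ j
        inner    : ∀ k → a < k → k < b → φ R (u ++ seg y a k) ∈ S

    PathI : List T → T → T → Interval n → Set
    PathI S i j (finite l y) = Path S i j y 0 l
    PathI S i j (infinite y) = ⊥

    module _ {S : List T} {i j : T} {y : ℕ → State n} where

      path-shift : ∀ p {a b} → Path S i j (y ∘ (p +_)) a b → Path S i j y (p + a) (p + b)
      path-shift p {a} {b} π = record
        { nonempty = +-monoʳ-< p nonempty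
        ; u        = u
        ; from     = from
        ; to       = trans (cong (λ s → φ R (u ++ s)) (sym (seg-shift y p a b))) to
        ; inner    = λ k a<k k<b → subst (λ k → φ R (u ++ seg y (p + a) k) ∈ S) (m+[n∸m]≡n (p≤ a<k))
            (subst (_∈ S) (cong (λ s → φ R (u ++ s)) (seg-shift y p a (k ∸ p)))
              (inner (k ∸ p) (+-cancelˡ-< p a (k ∸ p) (subst (p + a <_) (sym (m+[n∸m]≡n (p≤ a<k))) a<k))
                (+-cancelˡ-< p (k ∸ p) b (subst (_< p + b) (sym (m+[n∸m]≡n (p≤ a<k))) k<b))))
        }
        where
          open Path π
          p≤ : ∀ {k} → p + a < k → p ≤ k
          p≤ lt = ≤-trans (m≤m+n p a) (<⇒≤ lt)

      path-shift⁻ : ∀ p {a b} → Path S i j y (p + a) (p + b) → Path S i j (y ∘ (p +_)) a b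
      path-shift⁻ p {a} {b} π = record
        { nonempty = +-cancelˡ-< p a b nonempty
        ; u        = u
        ; from     = from
        ; to       = trans (cong (λ s → φ R (u ++ s)) (seg-shift y p a b)) to
        ; inner    = λ k a<k k<b → subst (_∈ S) (cong (λ s → φ R (u ++ s)) (sym (seg-shift y p a k)))
            (inner (p + k) (+-monoʳ-< p a<k) (+-monoʳ-< p k<b))
        }
        where open Path π

      path-sub : ∀ {a b} → a ≤ b → Path S i j (y ∘ (a +_)) 0 (b ∸ a) → Path S i j y a b
      path-sub {a} a≤b π =
        subst₂ (Path S i j y) (+-identityʳ a) (m+[n∸m]≡n a≤b) (path-shift a π)

      path-sub⁻ : ∀ {a b} → a ≤ b → Path S i j y a b → Path S i j (y ∘ (a +_)) 0 (b ∸ a)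
      path-sub⁻ {a} a≤b π = path-shift⁻ a
        (subst₂ (Path S i j y) (sym (+-identityʳ a)) (sym (m+[n∸m]≡n a≤b)) π)

    path-weaken : ∀ {S q i j y a b} → Path S i j y a b → Path (q ∷ S) i j y a b
    path-weaken π = record
      { nonempty = nonempty ; u = u ; from = from ; to = to
      ; inner = λ k a<k k<b → there (inner k a<k k<b) }
      where open Path π

    -- The two paths may represent q by different words; `comp` allows the second one to be replaced
    -- by the word read along the first path.
    path-join : ∀ {S q i j y a b c} → Path (q ∷ S) i q y a b → Path (q ∷ S) q j y b c →
                Path (q ∷ S) i j y a c
    path-join {S} {q} {i} {j} {y} {a} {b} {c} π ρ = record
      { nonempty = <-trans π.nonempty ρ.nonempty
      ; u        = π.u
      ; from     = π.from
      ; to       = trans (beyond (<⇒≤ ρ.nonempty)) ρ.to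
      ; inner    = inner
      }
      where
        module π = Path π
        module ρ = Path ρ
        beyond : ∀ {k} → b ≤ k → φ R (π.u ++ seg y a k) ≡ φ R (ρ.u ++ seg y b k)
        beyond {k} b≤k = trans (cong (φ R) (trans
            (cong (π.u ++_) (sym (seg-++ y (<⇒≤ π.nonempty) b≤k)))
            (sym (++-assoc π.u (seg y a b) (seg y b k)))))
          (comp R (trans π.to (sym ρ.from)) refl)
        inner : ∀ k → a < k → k < c → φ R (π.u ++ seg y a k) ∈ (q ∷ S)
        inner k a<k k<c with <-cmp k b
        ... | tri< k<b _ _  = π.inner k a<k k<b
        ... | tri≈ _ refl _ = here π.to
        ... | tri> _ _ b<k  = subst (_∈ (q ∷ S)) (sym (beyond (<⇒≤ b<k))) (ρ.inner k b<k k<c)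

    -- One transition of the automaton whose states are the types. The type i is represented by any
    -- word `u` of that value, and by `comp` the choice is immaterial. Of the two states of the
    -- interval only the first is read.
    step : T → T → ITL n
    step i j = ○ single ∧′ first (λ a → ∃[ u ] φ R u ≡ i × φ R (u ++ [ a ]) ≡ j)

    -- Kleene's recursion on the admissible intermediate types: q is avoided, or the path is cut at
    -- its visits to q. Chop acts as concatenation, since the shared state is read only by the right
    -- part. A single visit to q is the case where `✶` holds of one state.
    path : List T → T → T → ITL n
    path []      i j = step i j
    path (q ∷ S) i j = path S i j ∨′ (path S i q ⨾ (path S q q ✶ ⨾ path S q j))

    path⇒Path : ∀ S i j σ → σ ⊨ path S i j → PathI S i j σ
    path⇒Path [] i j (infinite y) p
      with ∧′⁻ {σ = infinite y} (○ single) (first λ a → ∃[ u ] φ R u ≡ i × φ R (u ++ [ a ]) ≡ j) p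
    ... | (_ , ¬1) , _ = ¬1 (tt , id)
    path⇒Path [] i j (finite l y) p
      with ∧′⁻ {σ = finite l y} (○ single) (first λ a → ∃[ u ] φ R u ≡ i × φ R (u ++ [ a ]) ≡ j) p
    ... | (1≤l , ¬1) , f with first⁻ _ {finite l y} f
    ...   | u , from , to = record
            { nonempty = 1≤l
            ; u        = u
            ; from     = from
            ; to       = trans (cong (λ l → φ R (u ++ seg y 0 l)) l≡1)
                           (trans (cong (λ s → φ R (u ++ s)) (seg-[-] y 0)) to)
            ; inner    = λ k 0<k k<l → contradiction (subst (k <_) l≡1 k<l) (≤⇒≯ 0<k)
            }
      where
        l≡1 : l ≡ 1
        l≡1 = ≤-antisym (m∸n≡0⇒m≤n (n<1⇒n≡0 (≰⇒> λ 1≤ → ¬1 (1≤ , id)))) 1≤l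
    path⇒Path (q ∷ S) i j (infinite y) p
      with ∨′⁻ {σ = infinite y} (path S i j) (path S i q ⨾ (path S q q ✶ ⨾ path S q j)) p
    ... | inj₁ r = path⇒Path S i j (infinite y) r
    ... | inj₂ (k , _ , _ , k′ , _ , _ , r) = path⇒Path S q j (infinite (y ∘ (k +_) ∘ (k′ +_))) r
    path⇒Path (q ∷ S) i j (finite l y) p
      with ∨′⁻ {σ = finite l y} (path S i j) (path S i q ⨾ (path S q q ✶ ⨾ path S q j)) p
    ... | inj₁ r = path-weaken (path⇒Path S i j (finite l y) r)
    ... | inj₂ (k , k≤l , r₁ , k′ , k′≤ , r₂ , r₃) =
          path-join (path-weaken (path⇒Path S i q (finite k y) r₁))
            (path-sub k≤l (after (star r₂)))
      where
        z : ℕ → State n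
        z = y ∘ (k +_)
        star : finite k′ z ⊨ path S q q ✶ → k′ ≡ 0 ⊎ Path (q ∷ S) q q z 0 k′
        star (inj₁ ¬1)        = inj₁ (n<1⇒n≡0 (≰⇒> ¬1))
        star (inj₂ (inj₂ D)) with () ← InfiniteDivision.σ-infinite D
        star (inj₂ (inj₁ D)) = inj₂ (extend (prefix m ≤-refl))
          where
            open FiniteDivision D renaming (k to c)
            joined : ∀ {a b} → a ≡ 0 ⊎ Path (q ∷ S) q q z 0 a → Path (q ∷ S) q q z a b →
                     Path (q ∷ S) q q z 0 b
            joined (inj₁ refl) π = π
            joined (inj₂ ρ)    π = path-join ρ π
            prefix : ∀ a → a ≤ m → c a ≡ 0 ⊎ Path (q ∷ S) q q z 0 (c a)
            prefix zero    _   = inj₁ start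
            prefix (suc a) a<m = inj₂ (joined (prefix a (<⇒≤ a<m)) (path-weaken
              (path-sub (<⇒≤ (increasing a a<m)) (path⇒Path S q q _ (pieces a a<m)))))
            extend : c m ≡ 0 ⊎ Path (q ∷ S) q q z 0 (c m) → Path (q ∷ S) q q z 0 k′
            extend r = joined r (path-weaken
              (path-sub (≤-trans (n≤1+n _) last-two) (path⇒Path S q q _ last-piece)))
        after : k′ ≡ 0 ⊎ Path (q ∷ S) q q z 0 k′ → Path (q ∷ S) q j z 0 (l ∸ k)
        after (inj₁ refl) = path-weaken (path⇒Path S q j _ r₃)
        after (inj₂ ρ)    = path-join ρ (path-weaken (path-sub k′≤ (path⇒Path S q j _ r₃)))

    -- The path is cut at its first visit `c` and its last visit `d` to q; the visits in between are
    -- the marks from which `marks⇒division` builds the star.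
    Path⇒path : ∀ S i j l y → Path S i j y 0 l → finite l y ⊨ path S i j
    Path⇒path [] i j l y π = ∧′⁺ {σ = finite l y} {○ single} {first _}
        (nonempty , λ { (1≤ , _) → two l≡1 1≤ })
        (first⁺ (λ a → ∃[ u ] φ R u ≡ i × φ R (u ++ [ a ]) ≡ j) {finite l y}
          (u , from , trans (cong (λ s → φ R (u ++ s)) (sym (trans (cong (seg y 0) l≡1) (seg-[-] y 0)))) to))
      where
        open Path π
        l≡1 : l ≡ 1
        l≡1 with m≤n⇒m<n∨m≡n nonempty
        ... | inj₂ eq  = sym eq
        ... | inj₁ 1<l with () ← inner 1 ≤-refl 1<l
        two : l ≡ 1 → ¬ 1 ≤ l ∸ 1
        two refl ()
    Path⇒path (q ∷ S) i j l y π = decompose em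
      where
        open Path π
        run : ℕ → T
        run k = φ R (u ++ seg y 0 k)
        Visit : ℕ → Set
        Visit k = (0 < k × k < l) × run k ≡ q
        segment : ∀ {i j a b} → a < b → b ≤ l → run a ≡ i → run b ≡ j →
                  (∀ k → a < k → k < b → ¬ Visit k) → Path S i j y a b
        segment {i} {j} {a} {b} a<b b≤l ra rb none = record
          { nonempty = a<b
          ; u        = u ++ seg y 0 a
          ; from     = ra
          ; to       = trans (split (<⇒≤ a<b)) rb
          ; inner    = λ k a<k k<b → subst (_∈ S) (sym (split (<⇒≤ a<k)))
              (other k (inner k (≤-<-trans z≤n a<k) (≤-trans k<b b≤l))
                 λ eq → none k a<k k<b ((≤-<-trans z≤n a<k , ≤-trans k<b b≤l) , eq))
          }
          where
            split : ∀ {k} → a ≤ k → φ R ((u ++ seg y 0 a) ++ seg y a k) ≡ run k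
            split a≤k = cong (φ R) (trans (++-assoc u _ _) (cong (u ++_) (seg-++ y z≤n a≤k)))
            other : ∀ k → run k ∈ (q ∷ S) → run k ≢ q → run k ∈ S
            other k (here eq)  ne = contradiction eq ne
            other k (there r∈) _  = r∈
        run-0 : run 0 ≡ i
        run-0 = trans (cong (φ R) (trans (cong (u ++_) (seg-[] y 0)) (++-identityʳ u))) from
        decompose : Dec (∃[ k ] Visit k) → finite l y ⊨ path (q ∷ S) i j
        decompose (no never) = ∨′⁺ˡ {σ = finite l y} (path S i j) (path S i q ⨾ (path S q q ✶ ⨾ path S q j))
          (Path⇒path S i j l y (segment nonempty ≤-refl run-0 to λ k _ _ v → never (k , v)))
        decompose (yes (v₀ , visit)) with least {Visit} visit | greatest {Visit} l visit (λ _ v → proj₂ (proj₁ v))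
        ... | c , ((0<c , c<l) , rc) , before | d , ((0<d , d<l) , rd) , beyond =
              ∨′⁺ʳ {σ = finite l y} (path S i j) (path S i q ⨾ (path S q q ✶ ⨾ path S q j))
                (c , <⇒≤ c<l ,
                 Path⇒path S i q c y (segment 0<c (<⇒≤ c<l) run-0 rc λ k _ k<c → before k k<c) ,
                 d ∸ c , ∸-monoˡ-≤ c (<⇒≤ d<l) , star em ,
                 Path⇒path S q j (l ∸ c ∸ (d ∸ c)) (z ∘ ((d ∸ c) +_))
                   (path-sub⁻ (∸-monoˡ-≤ c (<⇒≤ d<l)) (path-shift⁻ c
                     (subst₂ (Path S q j y) (sym c+) (sym (m+[n∸m]≡n (<⇒≤ c<l)))
                       (segment d<l ≤-refl rd to λ k d<k _ → beyond k d<k)))))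
          where
            z : ℕ → State n
            z = y ∘ (c +_)
            c≤d : c ≤ d
            c≤d = ≮⇒≥ λ d<c → before d d<c ((0<d , d<l) , rd)
            c+ : c + (d ∸ c) ≡ d
            c+ = m+[n∸m]≡n c≤d
            -- The end point, though a visit, is excluded: as a mark it would require a last piece
            -- of a single state.
            μ : ℕ → Set
            μ k = k < d ∸ c × run (c + k) ≡ q
            no-visit : ∀ {a b} → b ≤ d ∸ c → (∀ k → a < k → k < b → ¬ μ k) →
                       ∀ k → c + a < k → k < c + b → ¬ Visit k
            no-visit {a} {b} b≤ none k a<k k<b (_ , rk) = none (k ∸ c)
                (+-cancelˡ-< c _ _ (subst (c + a <_) (sym k≡) a<k)) k∸c<b
                (≤-trans k∸c<b b≤ , trans (cong run k≡) rk)
              where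
                k≡ : c + (k ∸ c) ≡ k
                k≡ = m+[n∸m]≡n (≤-trans (m≤m+n c a) (<⇒≤ a<k))
                k∸c<b : k ∸ c < b
                k∸c<b = +-cancelˡ-< c _ _ (subst (_< c + b) (sym k≡) k<b)
            piece : ∀ {a b} → a < b → b ≤ d ∸ c → run (c + a) ≡ q → run (c + b) ≡ q →
                    (∀ k → a < k → k < b → ¬ μ k) → finite (b ∸ a) (z ∘ (a +_)) ⊨ path S q q
            piece {a} {b} a<b b≤ ra rb none = Path⇒path S q q (b ∸ a) (z ∘ (a +_))
              (path-sub⁻ (<⇒≤ a<b) (path-shift⁻ c (segment (+-monoʳ-< c a<b)
                (≤-trans (+-monoʳ-≤ c b≤) (≤-trans (≤-reflexive c+) (<⇒≤ d<l))) ra rb (no-visit b≤ none))))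
            star : Dec (1 ≤ d ∸ c) → finite (d ∸ c) z ⊨ path S q q ✶
            star (no ¬1)   = inj₁ ¬1
            star (yes 1≤d) = inj₂ (marks⇒division {P = _⊨ path S q q} {σ = finite (d ∸ c) z} {μ} record
              { start       = 1≤d , trans (cong run (+-identityʳ c)) rc
              ; consecutive = λ a b a<b b≤ (_ , ra) (_ , rb) none → piece a<b b≤ ra rb none
              ; last        = λ a a≤ (a<d , ra) none → a<d ,
                  piece a<d ≤-refl ra (trans (cong run c+) rd)
                    λ k a<k k<d → none k a<k (<⇒≤ k<d)
              })

    -- The intervals whose states except the last one form a word of type t.
    typed : T → ITL n
    typed t = path (allFin (size R)) (φ R []) t

    typed⁺ : ∀ {l y t} → 0 < l → φ R (seg y 0 l) ≡ t → finite l y ⊨ typed t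
    typed⁺ {l} {y} 0<l eq = Path⇒path (allFin (size R)) _ _ l y record
      { nonempty = 0<l ; u = [] ; from = refl ; to = eq ; inner = λ _ _ _ → ∈-allFin _ }

    typed⁻ : ∀ {l y t} → finite l y ⊨ typed t → 0 < l × φ R (seg y 0 l) ≡ t
    typed⁻ {l} {y} p = nonempty , trans (comp R (sym from) refl) to
      where open Path (path⇒Path (allFin (size R)) _ _ (finite l y) p)

    typed-finite : ∀ {y t} → ¬ infinite y ⊨ typed t
    typed-finite {y} p = path⇒Path (allFin (size R)) _ _ (infinite y) p

    -- The formula that defines a recognisable property

    private
      -- One witness speaks for all: whether P holds of a finite interval depends only on its last
      -- state and on the type of the word before it, as `conclude` shows.
      Last : T → State n → Set
      Last t a = ∃[ m ] ∃[ x ] φ R (seg x 0 m) ≡ t × x m ≡ a × P (finite m x)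

      ending : T → ITL n
      ending t = single ∧′ first (Last t)

      -- One witness speaks for all: by `inf`, any two infinite sequences divided into nonempty
      -- words of types s, e, e, and so on agree on P.
      Periodic : T → T → Set
      Periodic s e = ∃[ x ] Σ (ℕ → ℕ) λ k → 0 < k 0 × (∀ i → k i < k (suc i)) ×
        φ R (seg x 0 (k 0)) ≡ s × (∀ i → φ R (seg x (k i) (k (suc i))) ≡ e) × P (infinite x)

      endless : ITL n
      endless = ¬′ (⊤′ ⨾ single)

      -- `✶` also admits finitely many pieces. On an infinite interval the last of these would be
      -- infinite, which `typed e` rules out; `endless` excludes the finite intervals.
      repeating : T → T → ITL n
      repeating s e = typed s ⨾ (endless ∧′ typed e ✶)

      -- A single state needs its own disjunct, since `typed t` holds only of intervals with at
      -- least two states.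
      short long forever : ITL n
      short   = ending (φ R [])
      long    = ⋁ (λ t → typed t ⨾ ending t)
      forever = ⋁ (λ s → ⋁ (λ e → when (Periodic s e) (repeating s e)))

    formula : ITL n
    formula = short ∨′ long ∨′ forever

    private
      ending⁻ : ∀ {t σ} → σ ⊨ ending t → ¬ Position σ 1 × Last t (at σ 0)
      ending⁻ {t} {σ} p with ∧′⁻ {σ = σ} single (first (Last t)) p
      ... | ¬1 , f = (λ 1∈ → ¬1 (1∈ , id)) , first⁻ (Last t) {σ} f

      ending⁺ : ∀ {t σ} → ¬ Position σ 1 → Last t (at σ 0) → σ ⊨ ending t
      ending⁺ {t} {σ} ¬1 l = ∧′⁺ {σ = σ} {single} {first (Last t)} (λ { (1∈ , _) → ¬1 1∈ })
        (first⁺ (Last t) {σ} l)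

      conclude : ∀ {t m y} → φ R (seg y 0 m) ≡ t → Last t (y m) → P (finite m y)
      conclude {m = m} {y} eq (m′ , x , eq′ , xm , p) = fin R (begin
        φ R (seg x 0 (suc m′))       ≡⟨ cong (φ R) (seg-∷ʳ x z≤n) ⟩
        φ R (seg x 0 m′ ++ [ x m′ ]) ≡⟨ comp R (trans eq′ (sym eq)) (cong (λ a → φ R [ a ]) xm) ⟩
        φ R (seg y 0 m ++ [ y m ])   ≡⟨ cong (φ R) (sym (seg-∷ʳ y z≤n)) ⟩
        φ R (seg y 0 (suc m))        ∎) p
        where open ≡-Reasoning

      single-suffix : ∀ {m k} → k ≤ m → ¬ 1 ≤ m ∸ k → k ≡ m
      single-suffix {m} {k} k≤m ¬1 = ≤-antisym k≤m (m∸n≡0⇒m≤n (n<1⇒n≡0 (≰⇒> ¬1)))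

      soundness : ∀ σ → σ ⊨ formula → P σ
      soundness σ p with ∨′⁻ {σ = σ} short (long ∨′ forever) p
      soundness (infinite y) p | inj₁ s = contradiction tt (proj₁ (ending⁻ {σ = infinite y} s))
      soundness (finite m y) p | inj₁ s with ending⁻ {σ = finite m y} s
      ... | ¬1 , l with n<1⇒n≡0 (≰⇒> ¬1)
      ...   | refl = conclude {m = 0} {y} (cong (φ R) (seg-[] y 0)) l
      soundness σ p | inj₂ q with ∨′⁻ {σ = σ} long forever q
      soundness σ p | inj₂ q | inj₁ r with ⋁⁻ {σ = σ} (λ t → typed t ⨾ ending t) r
      soundness (infinite y) p | inj₂ q | inj₁ r | t , k , _ , _ , e =
        contradiction tt (proj₁ (ending⁻ {t} {infinite (y ∘ (k +_))} e))
      soundness (finite m y) p | inj₂ q | inj₁ r | t , k , k≤m , a , e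
        with ending⁻ {t} {finite (m ∸ k) (y ∘ (k +_))} e
      ... | ¬1 , l with single-suffix k≤m ¬1
      ...   | refl = conclude {m = k} {y} (proj₂ (typed⁻ a)) (subst (λ i → Last t (y i)) (+-identityʳ k) l)
      soundness σ p | inj₂ q | inj₂ r
        with ⋁⁻ {σ = σ} (λ s → ⋁ (λ e → when (Periodic s e) (repeating s e))) r
      ... | s , r′ with ⋁⁻ {σ = σ} (λ e → when (Periodic s e) (repeating s e)) r′
      ...   | e , r″ with when⁻ (repeating s e) {σ} r″
      soundness (finite m y) p | inj₂ q | inj₂ r | s , r′ | e , r″ | _ , k , k≤m , _ , w =
        contradiction {A = finite (m ∸ k) (y ∘ (k +_)) ⊨ ⊤′ ⨾ single}
          (m ∸ k , ≤-refl , id , λ { (1≤ , _) → <-irrefl refl (subst (1 ≤_) (n∸n≡0 (m ∸ k)) 1≤) })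
          (proj₁ (∧′⁻ {σ = finite (m ∸ k) (y ∘ (k +_))} endless (typed e ✶) w))
      soundness (infinite y) p | inj₂ q | inj₂ r | s , r′ | e , r″ |
        (x , c , 0<c , inc , first-type , types , px) , k , _ , a , w
        with proj₂ (∧′⁻ {σ = infinite (y ∘ (k +_))} endless (typed e ✶) w)
      ... | inj₁ ¬1 = contradiction tt ¬1
      ... | inj₂ (inj₁ D) = contradiction (FiniteDivision.last-piece D)
              (typed-finite {y ∘ (k +_) ∘ (FiniteDivision.k D (FiniteDivision.m D) +_)} {e})
      ... | inj₂ (inj₂ D) = inf R (cuts refl (shifted-inc 0<c inc)) (cuts refl
              (shifted-inc (subst (0 <_) (sym k+d0) (proj₁ (typed⁻ a))) λ i → +-monoʳ-< k (increasing i)))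
              same px
        where
          open InfiniteDivision D renaming (k to d)
          -- Prepending the cut 0 makes the initial word of type s the first piece of the division.
          shifted : (ℕ → ℕ) → ℕ → ℕ
          shifted c zero    = 0
          shifted c (suc i) = c i
          shifted-inc : ∀ {c : ℕ → ℕ} → 0 < c 0 → (∀ i → c i < c (suc i)) →
                        ∀ i → shifted c i < shifted c (suc i)
          shifted-inc 0<c inc zero    = 0<c
          shifted-inc 0<c inc (suc i) = inc i
          k+d0 : k + d 0 ≡ k
          k+d0 = trans (cong (k +_) start) (+-identityʳ k)
          piece : ∀ i → φ R (seg y (k + d i) (k + d (suc i))) ≡ e
          piece i = trans (cong (φ R) (sym (trans (seg-shift (y ∘ (k +_)) (d i) 0 (d (suc i) ∸ d i))
              (trans (cong₂ (seg (y ∘ (k +_))) (+-identityʳ (d i)) (m+[n∸m]≡n (<⇒≤ (increasing i))))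
                     (seg-shift y k (d i) (d (suc i)))))))
            (proj₂ (typed⁻ (pieces i)))
          same : ∀ i → φ R (seg x (shifted c i) (shifted c (suc i))) ≡
                       φ R (seg y (shifted (λ i → k + d i) i) (shifted (λ i → k + d i) (suc i)))
          same zero    = trans first-type (sym (trans (cong (λ j → φ R (seg y 0 j)) k+d0) (proj₂ (typed⁻ a))))
          same (suc i) = trans (types i) (sym (piece i))

      Homogeneous : (ℕ → State n) → Set
      Homogeneous y = ∃[ e ] Σ (ℕ → ℕ) λ k → 0 < k 0 × (∀ i → k i < k (suc i)) ×
        (∀ i → φ R (seg y (k i) (k (suc i))) ≡ e)

      periodic : ∀ y → P (infinite y) → Homogeneous y → infinite y ⊨ forever
      periodic y p (e , k , 0<k , inc , types) =
        ⋁⁺ {σ = infinite y} (λ s → ⋁ (λ e → when (Periodic s e) (repeating s e))) s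
          (⋁⁺ {σ = infinite y} (λ e → when (Periodic s e) (repeating s e)) e
            -- The sequence `y` is itself the witness for `Periodic`.
            (when⁺ {A = repeating s e} {σ = infinite y} (y , k , 0<k , inc , refl , types , p)
              (k 0 , tt , typed⁺ {k 0} {y} {s} 0<k refl ,
                ∧′⁺ {σ = infinite (y ∘ (k 0 +_))} {endless} {typed e ✶}
                  (λ { (_ , _ , _ , ¬1) → ¬1 (tt , id) }) (inj₂ (inj₂ division)))))
        where
          s : T
          s = φ R (seg y 0 (k 0))
          d-increasing : ∀ i → k i ∸ k 0 < k (suc i) ∸ k 0
          d-increasing i = ∸-monoˡ-< (inc i) (mono inc z≤n)
          piece : ∀ i → φ R (seg (y ∘ (k 0 +_) ∘ ((k i ∸ k 0) +_)) 0 (k (suc i) ∸ k 0 ∸ (k i ∸ k 0))) ≡ e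
          piece i = trans (cong (φ R)
            (trans (seg-shift (y ∘ (k 0 +_)) (k i ∸ k 0) 0 _)
            (trans (cong₂ (seg (y ∘ (k 0 +_))) (+-identityʳ (k i ∸ k 0)) (m+[n∸m]≡n (<⇒≤ (d-increasing i))))
            (trans (seg-shift y (k 0) (k i ∸ k 0) (k (suc i) ∸ k 0))
                   (cong₂ (seg y) (m+[n∸m]≡n (mono inc z≤n)) (m+[n∸m]≡n (mono inc z≤n))))))) (types i)
          division : InfiniteDivision (_⊨ typed e) (infinite (y ∘ (k 0 +_)))
          division = record
            { σ-infinite = tt
            ; k          = λ i → k i ∸ k 0
            ; start      = n∸n≡0 (k 0)
            ; increasing = d-increasing
            ; pieces     = λ i → typed⁺ (m<n⇒0<n∸m (d-increasing i)) (piece i)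
            }

      completeness : ∀ σ → P σ → σ ⊨ formula
      completeness (finite zero y) p = ∨′⁺ˡ {σ = finite 0 y} short (long ∨′ forever)
        (ending⁺ {σ = finite 0 y} (λ ()) (0 , y , cong (φ R) (seg-[] y 0) , refl , p))
      completeness (finite (suc m) y) p =
        ∨′⁺ʳ {σ = finite (suc m) y} short (long ∨′ forever)
          (∨′⁺ˡ {σ = finite (suc m) y} long forever
            (⋁⁺ {σ = finite (suc m) y} (λ t → typed t ⨾ ending t) t (suc m , ≤-refl , front , end)))
        where
          t : T
          t = φ R (seg y 0 (suc m))
          front : finite (suc m) y ⊨ typed t
          front = typed⁺ {suc m} {y} {t} z<s refl
          end : finite (m ∸ m) (y ∘ (suc m +_)) ⊨ ending t
          end = ending⁺ {t} {finite (m ∸ m) (y ∘ (suc m +_))}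
            (λ 1≤ → <-irrefl refl (subst (1 ≤_) (n∸n≡0 m) 1≤))
            (suc m , y , refl , sym (cong y (+-identityʳ (suc m))) , p)
      completeness (infinite y) p = ∨′⁺ʳ {σ = infinite y} short (long ∨′ forever)
        (∨′⁺ʳ {σ = infinite y} long forever
          (periodic y p (ramsey (λ a b → φ R (seg y a b)))))

    recognisable⇒definable : ∃[ A ] (∀ σ → σ ⊨ A ⇔ P σ)
    recognisable⇒definable = formula , λ σ → mk⇔ (soundness σ) (completeness σ)

theorem10 : ExcludedMiddle 0ℓ → (n : ℕ) (A w : ITL n) → IsState w →
    ∃[ A′ ] (∀ (σ : Interval n) → (σ ⊨ A′) ⇔ (σ ⊨ w Π⁻¹ A))
theorem10 em n A w _ = recognisable⇒definable (rec-Π⁻¹ w A (rec-⊨ A))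
  where open Classical em
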